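{- Let $n\geq4$. A connected graph $G$ other than $K_2$ contains an induced $n$-cycle if and only if the reduction of $G$ contains an induced $n$-cycle. In particular, for every $m\geq1$, the sibling number and the tuft number have joint symmetric distribution on the set of unlabeled connected chordal graphs with $m$ vertices (chordal graphs being those with no induced cycle on $4$ or more vertices); i.e. $\sum_G x^{s(G)}y^{t(G)}$ over these graphs is symmetric in $x$ and $y$.
   Context: Graphs are finite and simple. A leaf is a vertex of degree one; two distinct vertices are siblings if they have the same closed neighborhood $N[v]=\{v\}\cup N(v)$. The sibling number is $s(G)=\max_v\lvert\{u:N[u]=N[v]\}\rvert-1$ and the tuft number $t(G)$ is the maximal number of leaves adjacent to a single vertex. The reduction of a connected graph other than $K_2$ is obtained by repeatedly removing all leaves and contracting each maximal group of siblings to a single vertex until a graph with neither leaves nor siblings is reached. -}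

module Defs where

open import Data.Bool.Base using (Bool; true; false; not; _∧_; _∨_; if_then_else_; T)
open import Data.Bool.Properties as Bool using (∨-comm; ∨-idem)
open import Data.Fin.Base using (Fin; zero; suc; toℕ; fromℕ<; punchOut; finToFun; funToFin)
open import Data.Fin.Properties using (_≟_; any?; all?; finToFun-funToFin; punchOut-injective; injective⇒≤; toℕ-fromℕ<)
open import Data.Fin.Subset using (Subset; _∈_; _∪_; ⁅_⁆; ∣_∣)
open import Data.Fin.Subset.Properties using (x∈⁅x⁆; x∈⁅y⁆⇒x≡y; x∈p∪q⁺; x∈p∪q⁻)
open import Data.List.Base as List using (List; []; _∷_; allFin; filter; deduplicate)
open import Data.List.Membership.Propositional using () renaming (_∈_ to _∈ₗ_)
open import Data.List.Membership.Propositional.Properties using (∈-allFin; ∈-filter⁺; ∈-filter⁻; ∈-lookup)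
open import Data.List.Relation.Unary.All as All using (All; []; _∷_)
import Data.List.Relation.Unary.All.Properties as All
open import Data.List.Relation.Unary.AllPairs using (AllPairs; []; _∷_)
import Data.List.Relation.Unary.AllPairs.Properties as AllPairs
open import Data.List.Relation.Unary.Any as Any using (Any; here; there)
import Data.List.Relation.Unary.Any.Properties as Any
open import Data.List.Relation.Unary.Unique.Propositional using (Unique)
import Data.List.Relation.Unary.Unique.Propositional.Properties as Unique
open import Data.Nat.Base using (ℕ; suc; _∸_; _^_; _⊔_; _≤_; _<_; NonZero; s≤s; ≢-nonZero; ≢-nonZero⁻¹)
open import Data.Nat.Induction using (<-wellFounded)
open import Data.Nat.ListAction using (sum)
import Data.Nat.Properties as ℕ
open import Data.Product.Base using (∃; ∃₂; _×_; _,_; proj₁; proj₂)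
open import Data.Sum.Base using (_⊎_; inj₁; inj₂)
open import Data.Unit.Base using (tt)
open import Data.Vec.Base using (tabulate)
import Data.Vec.Functional as Functional
open import Data.Vec.Properties using (≡-dec; lookup∘tabulate; lookup⇒[]=; []=⇒lookup)
open import Function.Base using (id)
open import Function.Bundles using (_⇔_; mk⇔; _↔_; mk↔ₛ′; Inverse)
open import Function.Construct.Composition using (_↔-∘_)
open import Function.Construct.Identity using (↔-id)
open import Function.Construct.Symmetry using (↔-sym)
open import Function.Definitions using (Injective; Surjective)
open import Induction.WellFounded using (Acc; acc)
open import Relation.Binary.Construct.Closure.ReflexiveTransitive as Star using (Star; ε; _◅_; _◅◅_)
open import Relation.Binary.PropositionalEquality
open import Relation.Nullary.Decidable using (Dec; yes; no; does; map′; dec-true; dec-false; _×-dec_; _⊎-dec_; _→-dec_; ¬?; T?)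
open import Relation.Nullary.Negation using (¬_; contradiction)

private variable
  k m n : ℕ

record Graph (n : ℕ) : Set where
  field
    adj        : Fin n → Fin n → Bool
    adj-sym    : ∀ u v → adj u v ≡ adj v u
    adj-irrefl : ∀ v → adj v v ≡ false

  Adj : Fin n → Fin n → Set
  Adj u v = T (adj u v)

open Graph public using (adj; adj-sym; adj-irrefl; Adj)

private
  mirrored : (Fin n → Fin n → Bool) → Fin n → Fin n → Bool
  mirrored M u v = not (does (u ≟ v)) ∧ (M u v ∨ M v u)

  ≟-comm : (u v : Fin n) → does (u ≟ v) ≡ does (v ≟ u)
  ≟-comm u v with u ≟ v
  ... | yes p = sym (dec-true (v ≟ u) (sym p))
  ... | no ¬p = sym (dec-false (v ≟ u) (≢-sym ¬p))

-- u and v are joined iff they are distinct and M relates them in at least one direction.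
fromRelation : (Fin n → Fin n → Bool) → Graph n
fromRelation M = record
  { adj        = mirrored M
  ; adj-sym    = λ u v → cong₂ (λ a b → not a ∧ b) (≟-comm u v) (∨-comm (M u v) (M v u))
  ; adj-irrefl = λ v → cong (λ a → not a ∧ (M v v ∨ M v v)) (dec-true (v ≟ v) refl)
  }

K : ∀ n → Graph n
K n = fromRelation (λ _ _ → true)

C : ∀ n → Graph n
C n = fromRelation next
  where
  next : Fin n → Fin n → Bool
  next i j = does (suc (toℕ i) ℕ.≟ toℕ j) ∨ (does (suc (toℕ i) ℕ.≟ n) ∧ does (toℕ j ℕ.≟ 0))

infix 4 _≅_

record _≅_ (G : Graph m) (H : Graph n) : Set where
  constructor iso
  field
    bij   : Fin m ↔ Fin n
    adj-≡ : ∀ u v → adj G u v ≡ adj H (Inverse.to bij u) (Inverse.to bij v)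

record InducedEmbedding (H : Graph k) (G : Graph n) : Set where
  constructor embedding
  field
    to        : Fin k → Fin n
    injective : Injective _≡_ _≡_ to
    adj-≡     : ∀ i j → adj H i j ≡ adj G (to i) (to j)

HasInducedCycle : ℕ → Graph m → Set
HasInducedCycle n G = InducedEmbedding (C n) G

Connected : Graph n → Set
Connected {n} G = NonZero n × (∀ u v → Star (Adj G) u v)

Chordal : Graph m → Set
Chordal G = ∀ n → 4 ≤ n → ¬ HasInducedCycle n G

maxOver : (Fin n → ℕ) → ℕ
maxOver = Functional.foldr _⊔_ 0

module _ (G : Graph n) where

  N : Fin n → Subset n
  N v = tabulate (adj G v)

  N[_] : Fin n → Subset n
  N[ v ] = ⁅ v ⁆ ∪ N v

  Leaf : Fin n → Set
  Leaf v = ∣ N v ∣ ≡ 1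

  leaf? : ∀ v → Dec (Leaf v)
  leaf? v = ∣ N v ∣ ℕ.≟ 1

  SameN[] : Fin n → Fin n → Set
  SameN[] u v = N[ u ] ≡ N[ v ]

  sameN[]? : ∀ u v → Dec (SameN[] u v)
  sameN[]? u v = ≡-dec Bool._≟_ N[ u ] N[ v ]

  Siblings : Fin n → Fin n → Set
  Siblings u v = u ≢ v × SameN[] u v

  siblingNumber : ℕ
  siblingNumber = maxOver (λ v → ∣ tabulate (λ u → does (sameN[]? u v)) ∣) ∸ 1

  tuftNumber : ℕ
  tuftNumber = maxOver (λ v → ∣ tabulate (λ u → does (leaf? u) ∧ adj G v u) ∣)

record RemovesLeaves (G : Graph n) (H : Graph k) : Set where
  field
    incl  : InducedEmbedding H G
    image : ∀ v → (¬ Leaf G v) ⇔ ∃ λ i → InducedEmbedding.to incl i ≡ v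

-- Contraction in the usual sense: the vertices of H are the classes of equal closed
-- neighbourhood, two distinct ones being adjacent iff some edge of G joins them.
record ContractsSiblings (G : Graph n) (H : Graph k) : Set where
  field
    π          : Fin n → Fin k
    surjective : Surjective _≡_ _≡_ π
    fibres     : ∀ u v → π u ≡ π v ⇔ SameN[] G u v
    edges      : ∀ a b → Adj H a b ⇔ (a ≢ b × ∃₂ λ u v → π u ≡ a × π v ≡ b × Adj G u v)

-- The two operations may be applied in any order. K 2 has both leaves and siblings; should
-- it occur on the way, it may either be contracted to K 1 or lose both of its vertices.
infix 4 _↠_

data _↠_ : Graph n → Graph k → Set where
  done             : {G : Graph n} → G ↠ G
  removeLeaves     : {G : Graph n} {H : Graph m} {R : Graph k} →
                     RemovesLeaves G H → H ↠ R → G ↠ R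
  contractSiblings : {G : Graph n} {H : Graph m} {R : Graph k} →
                     ContractsSiblings G H → H ↠ R → G ↠ R

Reduced : Graph n → Set
Reduced G = (∀ v → ¬ Leaf G v) × (∀ u v → ¬ Siblings G u v)

_IsReductionOf_ : Graph k → Graph n → Set
R IsReductionOf G = G ↠ R × Reduced R

-- The list Gs is a system of representatives for the isomorphism classes of graphs on
-- m vertices satisfying P, i.e. the set of unlabeled such graphs.
record Represents (P : Graph m → Set) (Gs : List (Graph m)) : Set where
  field
    sound    : All P Gs
    distinct : AllPairs (λ G H → ¬ G ≅ H) Gs
    complete : ∀ G → P G → Any (G ≅_) Gs

-- Polynomials in x and y with coefficients in ℕ: p a b is the coefficient of x^a y^b.
Polynomial : Set
Polynomial = ℕ → ℕ → ℕ

x^_y^_ : ℕ → ℕ → Polynomial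
(x^ i y^ j) a b = if does (i ℕ.≟ a) ∧ does (j ℕ.≟ b) then 1 else 0

Σ[_]_ : List (Graph m) → (Graph m → Polynomial) → Polynomial
(Σ[ Gs ] f) a b = sum (List.map (λ G → f G a b) Gs)

Symmetric : Polynomial → Set
Symmetric p = ∀ a b → p a b ≡ p b a

-- The remaining proofs show that IsReductionOf and Represents are not vacuous: every graph
-- has a reduction, and the unlabeled connected chordal graphs have a list of representatives.

private
  T-≡ : ∀ {a b} → a ≡ b → T a → T b
  T-≡ refl = id

  module Relations (G : Graph n) where

    Adj-sym : ∀ {u v} → Adj G u v → Adj G v u
    Adj-sym {u} {v} = T-≡ (adj-sym G u v)

    Adj-irrefl : ∀ {u v} → u ≡ v → ¬ Adj G u v
    Adj-irrefl {u} refl p = T-≡ (adj-irrefl G u) p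

    ∈N[]⁻ : ∀ {u v} → v ∈ N[_] G u → v ≡ u ⊎ Adj G u v
    ∈N[]⁻ {u} {v} v∈ with x∈p∪q⁻ ⁅ u ⁆ (N G u) v∈
    ... | inj₁ p = inj₁ (x∈⁅y⁆⇒x≡y u p)
    ... | inj₂ p = inj₂ (T-≡ (sym (trans (sym (lookup∘tabulate (adj G u) v)) ([]=⇒lookup p))) tt)

    ∈N[]-self : ∀ u → u ∈ N[_] G u
    ∈N[]-self u = x∈p∪q⁺ (inj₁ (x∈⁅x⁆ u))

    ∈N[]-adj : ∀ {u v} → Adj G u v → v ∈ N[_] G u
    ∈N[]-adj {u} {v} p = x∈p∪q⁺ {p = ⁅ u ⁆} (inj₂ (lookup⇒[]= v (N G u) (trans (lookup∘tabulate (adj G u) v) (T⇒≡ p))))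
      where
      T⇒≡ : ∀ {b} → T b → b ≡ true
      T⇒≡ {true} _ = refl

  injective-missing : (f : Fin k → Fin n) → Injective _≡_ _≡_ f →
                      ∀ v → (∀ i → f i ≢ v) → k < n
  injective-missing {n = suc n} f inj v miss =
    s≤s (injective⇒≤ {f = λ i → punchOut (λ eq → miss i (sym eq))}
      (λ eq → inj (punchOut-injective (λ e → miss _ (sym e)) (λ e → miss _ (sym e)) eq)))

  lookup-injective : ∀ {A : Set} {xs : List A} → Unique xs →
                     ∀ i j → List.lookup xs i ≡ List.lookup xs j → i ≡ j
  lookup-injective (_ ∷ _)  zero    zero    _  = refl
  lookup-injective (p ∷ _)  zero    (suc j) eq = contradiction eq (All.lookup p (∈-lookup j))
  lookup-injective (p ∷ _)  (suc i) zero    eq = contradiction (sym eq) (All.lookup p (∈-lookup i))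
  lookup-injective (_ ∷ ps) (suc i) (suc j) eq = cong suc (lookup-injective ps i j eq)

  module InducedSubgraph (G : Graph n) {P : Fin n → Set} (P? : ∀ v → Dec (P v)) where

    vertices : List (Fin n)
    vertices = filter P? (allFin n)

    size : ℕ
    size = List.length vertices

    at : Fin size → Fin n
    at = List.lookup vertices

    at-injective : Injective _≡_ _≡_ at
    at-injective {i} {j} = lookup-injective (Unique.filter⁺ P? (Unique.allFin⁺ n)) i j

    at-P : ∀ i → P (at i)
    at-P i = proj₂ (∈-filter⁻ P? {xs = allFin n} (∈-lookup i))

    private
      member : ∀ {v} → P v → v ∈ₗ vertices
      member {v} p = ∈-filter⁺ P? (∈-allFin v) p

    index : ∀ {v} → P v → Fin size
    index p = Any.index (member p)

    at-index : ∀ {v} (p : P v) → at (index p) ≡ v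
    at-index p = sym (Any.lookup-index (member p))

    graph : Graph size
    graph = record
      { adj        = λ i j → adj G (at i) (at j)
      ; adj-sym    = λ i j → adj-sym G (at i) (at j)
      ; adj-irrefl = λ i → adj-irrefl G (at i)
      }

    size< : ∀ v → ¬ P v → size < n
    size< v ¬p = injective-missing at at-injective v (λ i eq → ¬p (subst P eq (at-P i)))

  module LeafRemoval (G : Graph n) where
    open InducedSubgraph G (λ v → ¬? (leaf? G v)) public

    removes : RemovesLeaves G graph
    removes = record
      { incl  = embedding at at-injective (λ _ _ → refl)
      ; image = λ v → mk⇔ (λ ¬l → index ¬l , at-index ¬l) (λ { (i , refl) → at-P i })
      }

  module SiblingContraction (G : Graph n) where
    open Relations G

    pick : Fin n → Subset n → Fin n
    pick v X with any? (λ w → ≡-dec Bool._≟_ (N[_] G w) X)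
    ... | yes (w , _) = w
    ... | no _        = v

    rep : Fin n → Fin n
    rep v = pick v (N[_] G v)

    rep-same : ∀ v → SameN[] G (rep v) v
    rep-same v with any? (λ w → ≡-dec Bool._≟_ (N[_] G w) (N[_] G v))
    ... | yes (_ , eq) = eq
    ... | no _         = refl

    pick-const : ∀ u v w → pick u (N[_] G w) ≡ pick v (N[_] G w)
    pick-const u v w with any? (λ x → ≡-dec Bool._≟_ (N[_] G x) (N[_] G w))
    ... | yes _ = refl
    ... | no ¬p = contradiction (w , refl) ¬p

    same⇒rep≡ : ∀ {u v} → SameN[] G u v → rep u ≡ rep v
    same⇒rep≡ {u} {v} eq = trans (cong (pick u) eq) (pick-const u v v)

    rep≡⇒same : ∀ {u v} → rep u ≡ rep v → SameN[] G u v
    rep≡⇒same {u} {v} eq = trans (sym (rep-same u)) (trans (cong (N[_] G) eq) (rep-same v))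

    rep-idem : ∀ v → rep (rep v) ≡ rep v
    rep-idem v = same⇒rep≡ (rep-same v)

    open InducedSubgraph G (λ v → rep v ≟ v) public

    π : Fin n → Fin size
    π v = index (rep-idem v)

    at-π : ∀ v → at (π v) ≡ rep v
    at-π v = at-index (rep-idem v)

    π-at : ∀ i → π (at i) ≡ i
    π-at i = at-injective (trans (at-π (at i)) (at-P i))

    π≡⇒rep≡ : ∀ {u v} → π u ≡ π v → rep u ≡ rep v
    π≡⇒rep≡ eq = trans (sym (at-π _)) (trans (cong at eq) (at-π _))

    rep≡⇒π≡ : ∀ {u v} → rep u ≡ rep v → π u ≡ π v
    rep≡⇒π≡ eq = at-injective (trans (at-π _) (trans eq (sym (at-π _))))

    adj-repˡ : ∀ {u v} → rep u ≢ rep v → Adj G u v → Adj G (rep u) v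
    adj-repˡ {u} {v} u≁v uv with ∈N[]⁻ (subst (v ∈_) (sym (rep-same u)) (∈N[]-adj uv))
    ... | inj₁ v≡ = contradiction (sym (trans (cong rep v≡) (rep-idem u))) u≁v
    ... | inj₂ p  = p

    adj-rep : ∀ {u v} → rep u ≢ rep v → Adj G u v → Adj G (rep u) (rep v)
    adj-rep {u} {v} u≁v uv = Adj-sym (adj-repˡ (λ eq → u≁v (sym (trans eq (rep-idem u))))
      (Adj-sym (adj-repˡ u≁v uv)))

    contracts : ContractsSiblings G graph
    contracts = record
      { π          = π
      ; surjective = λ i → at i , λ { refl → π-at i }
      ; fibres     = λ u v → mk⇔ (λ eq → rep≡⇒same (π≡⇒rep≡ eq)) (λ eq → rep≡⇒π≡ (same⇒rep≡ eq))
      ; edges      = λ a b → mk⇔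
          (λ ab → (λ a≡b → Relations.Adj-irrefl graph a≡b ab) , at a , at b , π-at a , π-at b , ab)
          (λ { (a≢b , u , v , refl , refl , uv) →
            subst₂ (Adj G) (sym (at-π u)) (sym (at-π v))
              (adj-rep (λ eq → a≢b (rep≡⇒π≡ eq)) uv) })
      }

    shrinks : ∀ u v → Siblings G u v → size < n
    shrinks u v (u≢v , eq) with rep u ≟ u
    ... | no ¬p = size< u ¬p
    ... | yes p = size< v (λ q → u≢v (trans (sym p) (trans (same⇒rep≡ eq) q)))

  reduction-acc : (G : Graph n) → Acc _<_ n → ∃₂ λ k (R : Graph k) → R IsReductionOf G
  reduction-acc G (acc rs) with any? (leaf? G)
  ... | yes (v , l) =
    let k , R , H↠R , red = reduction-acc (LeafRemoval.graph G)
                              (rs (LeafRemoval.size< G v (λ ¬l → ¬l l)))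
    in k , R , removeLeaves (LeafRemoval.removes G) H↠R , red
  ... | no ¬leaf with any? (λ u → any? (λ v → ¬? (u ≟ v) ×-dec sameN[]? G u v))
  ...   | yes (u , v , s) =
    let k , R , H↠R , red = reduction-acc (SiblingContraction.graph G)
                              (rs (SiblingContraction.shrinks G u v s))
    in k , R , contractSiblings (SiblingContraction.contracts G) H↠R , red
  ...   | no ¬sib = _ , G , done , (λ v l → ¬leaf (v , l)) , (λ u v s → ¬sib (u , v , s))

reduction-exists : (G : Graph n) → ∃₂ λ k (R : Graph k) → R IsReductionOf G
reduction-exists {n} G = reduction-acc G (<-wellFounded n)

≅-sym : {G : Graph m} {H : Graph n} → G ≅ H → H ≅ G
≅-sym {H = H} (iso f eq) = iso (↔-sym f) λ u v →
  sym (trans (eq _ _) (cong₂ (adj H) (Inverse.strictlyInverseˡ f u) (Inverse.strictlyInverseˡ f v)))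

≅-trans : {G : Graph k} {H : Graph m} {I : Graph n} → G ≅ H → H ≅ I → G ≅ I
≅-trans (iso f p) (iso g q) = iso (g ↔-∘ f) λ u v → trans (p u v) (q _ _)

private
  function? : (P : (Fin m → Fin n) → Set) → (∀ {f g} → f ≗ g → P f → P g) →
              (∀ f → Dec (P f)) → Dec (∃ P)
  function? {m} {n} P resp P? = map′ (λ (c , p) → finToFun {n} {m} c , p)
    (λ (f , p) → funToFin f , resp (λ i → sym (finToFun-funToFin f i)) p)
    (any? (λ c → P? (finToFun {n} {m} c)))

_≅?_ : (G : Graph m) (H : Graph n) → Dec (G ≅ H)
_≅?_ {m} {n} G H = map′
    (λ (f , g , gf , fg , eq) → iso (mk↔ₛ′ f g fg gf) eq)
    (λ (iso b eq) → Inverse.to b , Inverse.from b , Inverse.strictlyInverseʳ b ,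
                    Inverse.strictlyInverseˡ b , eq)
    (function? (λ f → ∃ (P f)) P-resp₁ λ f → function? (P f) (P-resp₂ f) λ g →
      all? (λ x → g (f x) ≟ x) ×-dec all? (λ y → f (g y) ≟ y) ×-dec
      all? (λ u → all? λ v → adj G u v Bool.≟ adj H (f u) (f v)))
  where
  P : (Fin m → Fin n) → (Fin n → Fin m) → Set
  P f g = (∀ x → g (f x) ≡ x) × (∀ y → f (g y) ≡ y) × (∀ u v → adj G u v ≡ adj H (f u) (f v))

  P-resp₂ : ∀ f {g g′} → g ≗ g′ → P f g → P f g′
  P-resp₂ f e (p , q , r) = (λ x → trans (sym (e (f x))) (p x)) ,
    (λ y → trans (cong f (sym (e y))) (q y)) , r

  P-resp₁ : ∀ {f f′} → f ≗ f′ → ∃ (P f) → ∃ (P f′)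
  P-resp₁ e (g , p , q , r) = g , (λ x → trans (cong g (sym (e x))) (p x)) ,
    (λ y → trans (sym (e (g y))) (q y)) , λ u v → trans (r u v) (cong₂ (adj H) (e u) (e v))

module _ {R : Fin n → Fin n → Set} (R? : ∀ u v → Dec (R u v)) where
  private
    -- u and v are linked by R-steps whose intermediate vertices lie in the list.
    Via : List (Fin n) → Fin n → Fin n → Set
    Via []       u v = u ≡ v ⊎ R u v
    Via (w ∷ ws) u v = Via ws u v ⊎ (Via ws u w × Via ws w v)

    via? : ∀ ws u v → Dec (Via ws u v)
    via? []       u v = u ≟ v ⊎-dec R? u v
    via? (w ∷ ws) u v = via? ws u v ⊎-dec (via? ws u w ×-dec via? ws w v)

    via⇒star : ∀ ws {u v} → Via ws u v → Star R u v
    via⇒star []       (inj₁ refl)    = ε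
    via⇒star []       (inj₂ r)       = r ◅ ε
    via⇒star (w ∷ ws) (inj₁ p)       = via⇒star ws p
    via⇒star (w ∷ ws) (inj₂ (p , q)) = via⇒star ws p ◅◅ via⇒star ws q

    weaken : ∀ ws {u v} → Via [] u v → Via ws u v
    weaken []       p = p
    weaken (w ∷ ws) p = inj₁ (weaken ws p)

    join : ∀ {ws u v w} → w ∈ₗ ws → Via ws u w → Via ws w v → Via ws u v
    join (here refl) (inj₁ p)       (inj₁ q)       = inj₂ (p , q)
    join (here refl) (inj₁ p)       (inj₂ (_ , q)) = inj₂ (p , q)
    join (here refl) (inj₂ (p , _)) (inj₁ q)       = inj₂ (p , q)
    join (here refl) (inj₂ (p , _)) (inj₂ (_ , q)) = inj₂ (p , q)
    join (there i)   (inj₁ p)       (inj₁ q)       = inj₁ (join i p q)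
    join (there i)   (inj₁ p)       (inj₂ (q , r)) = inj₂ (join i p q , r)
    join (there i)   (inj₂ (p , q)) (inj₁ r)       = inj₂ (p , join i q r)
    join (there i)   (inj₂ (p , _)) (inj₂ (_ , q)) = inj₂ (p , q)

    star⇒via : ∀ {u v} → Star R u v → Via (allFin n) u v
    star⇒via ε        = weaken (allFin n) (inj₁ refl)
    star⇒via (r ◅ rs) = join (∈-allFin _) (weaken (allFin n) (inj₂ r)) (star⇒via rs)

  star? : ∀ u v → Dec (Star R u v)
  star? u v = map′ (via⇒star (allFin n)) star⇒via (via? (allFin n) u v)

connected? : (G : Graph n) → Dec (Connected G)
connected? {n} G = map′ (λ n≢0 → ≢-nonZero n≢0) (λ nz → ≢-nonZero⁻¹ n {{nz}}) (¬? (n ℕ.≟ 0))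
  ×-dec all? (λ u → all? (star? (λ a b → T? (adj G a b)) u))

embeds? : (H : Graph k) (G : Graph n) → Dec (InducedEmbedding H G)
embeds? {k} {n} H G = map′
    (λ (f , inj , eq) → embedding f (λ {i} {j} → inj i j) eq)
    (λ (embedding f inj eq) → f , (λ _ _ → inj) , eq)
    (function? P P-resp λ f → all? (λ i → all? λ j → (f i ≟ f j) →-dec (i ≟ j)) ×-dec
      all? (λ i → all? λ j → adj H i j Bool.≟ adj G (f i) (f j)))
  where
  P : (Fin k → Fin n) → Set
  P f = (∀ i j → f i ≡ f j → i ≡ j) × (∀ i j → adj H i j ≡ adj G (f i) (f j))

  P-resp : ∀ {f g} → f ≗ g → P f → P g
  P-resp e (p , q) = (λ i j eq → p i j (trans (e i) (trans eq (sym (e j))))) ,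
    λ i j → trans (q i j) (cong₂ (adj G) (e i) (e j))

chordal? : (G : Graph m) → Dec (Chordal G)
chordal? {m} G = map′
  (λ h n 4≤n c@(embedding _ inj _) →
    let n<1+m = s≤s (injective⇒≤ inj)
        eq    = toℕ-fromℕ< n<1+m
    in h (fromℕ< n<1+m) (subst (4 ≤_) (sym eq) 4≤n) (subst (λ l → HasInducedCycle l G) (sym eq) c))
  (λ h i → h (toℕ i))
  (all? {n = suc m} (λ i → (4 ℕ.≤? toℕ i) →-dec ¬? (embeds? (C (toℕ i)) G)))

connected-≅ : {G : Graph m} {H : Graph m} → G ≅ H → Connected G → Connected H
connected-≅ {G = G} {H} (iso f eq) (nz , conn) = nz , λ u v →
  subst₂ (Star (Adj H)) (Inverse.strictlyInverseˡ f u) (Inverse.strictlyInverseˡ f v)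
    (Star.gmap (Inverse.to f) (λ {a} {b} → T-≡ (eq a b)) (conn (Inverse.from f u) (Inverse.from f v)))

chordal-≅ : {G : Graph m} {H : Graph m} → G ≅ H → Chordal G → Chordal H
chordal-≅ {G = G} {H} G≅H ch n 4≤n (embedding c inj p) with iso g eq ← ≅-sym G≅H =
  ch n 4≤n (embedding (λ i → Inverse.to g (c i)) (λ e → inj (trans (sym (Inverse.strictlyInverseʳ g _))
      (trans (cong (Inverse.from g) e) (Inverse.strictlyInverseʳ g _))))
    (λ i j → trans (p i j) (eq _ _)))

private
  graphs : ∀ m → List (Graph m)
  graphs m = List.map (λ c → fromRelation (λ u v → does (finToFun {2} {m} (finToFun {2 ^ m} {m} c u) v ≟ zero)))
                      (allFin ((2 ^ m) ^ m))

  bit : Bool → Fin 2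
  bit true  = zero
  bit false = suc zero

  bit-correct : ∀ b → does (bit b ≟ zero) ≡ b
  bit-correct true  = refl
  bit-correct false = refl

  mirrored-adj : (G : Graph m) {M : Fin m → Fin m → Bool} → (∀ u v → M u v ≡ adj G u v) →
                 ∀ u v → adj G u v ≡ adj (fromRelation M) u v
  mirrored-adj G {M} eq u v with u ≟ v
  ... | yes refl = adj-irrefl G u
  ... | no _     = sym (trans (cong₂ _∨_ (eq u v) (trans (eq v u) (adj-sym G v u))) (∨-idem _))

  graphs-complete : (G : Graph m) → Any (G ≅_) (graphs m)
  graphs-complete {m} G = Any.map⁺ (Any.map (λ { refl → iso (↔-id _) (mirrored-adj G decode) })
                                            (∈-allFin code))
    where
    row : Fin m → Fin (2 ^ m)
    row u = funToFin (λ v → bit (adj G u v))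
    code : Fin ((2 ^ m) ^ m)
    code = funToFin row
    decode : ∀ u v → does (finToFun {2} {m} (finToFun {2 ^ m} {m} code u) v ≟ zero) ≡ adj G u v
    decode u v = trans
      (cong (λ x → does (x ≟ zero)) (trans (cong (λ r → finToFun {2} {m} r v) (finToFun-funToFin row u))
                                           (finToFun-funToFin (λ w → bit (adj G u w)) v)))
      (bit-correct (adj G u v))

  Any-filter⁺ : ∀ {A : Set} {P Q : A → Set} (P? : ∀ x → Dec (P x)) → (∀ {x} → Q x → P x) →
                ∀ xs → Any Q xs → Any Q (filter P? xs)
  Any-filter⁺ P? h (x ∷ xs) a with P? x
  Any-filter⁺ P? h (x ∷ xs) (here q)  | yes _ = here q
  Any-filter⁺ P? h (x ∷ xs) (there a) | yes _ = there (Any-filter⁺ P? h xs a)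
  Any-filter⁺ P? h (x ∷ xs) (here q)  | no ¬p = contradiction (h q) ¬p
  Any-filter⁺ P? h (x ∷ xs) (there a) | no _  = Any-filter⁺ P? h xs a

  deduplicate-distinct : (Gs : List (Graph m)) → AllPairs (λ G H → ¬ G ≅ H) (deduplicate _≅?_ Gs)
  deduplicate-distinct []       = []
  deduplicate-distinct (G ∷ Gs) =
    All.all-filter _ (deduplicate _≅?_ Gs) ∷ AllPairs.filter⁺ _ (deduplicate-distinct Gs)

representatives : ∀ m → ∃ (Represents {m} (λ G → Connected G × Chordal G))
representatives m = deduplicate _≅?_ (filter P? (graphs m)) , record
  { sound    = All.deduplicate⁺ _≅?_ (All.all-filter P? (graphs m))
  ; distinct = deduplicate-distinct (filter P? (graphs m))
  ; complete = λ G (conn , ch) → Any.deduplicate⁺ _≅?_ (λ H≅I G≅I → ≅-trans G≅I (≅-sym H≅I))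
      (Any-filter⁺ P? (λ G≅H → connected-≅ G≅H conn , chordal-≅ G≅H ch) (graphs m) (graphs-complete G))
  }
  where
  P? : (G : Graph m) → Dec (Connected G × Chordal G)
  P? G = connected? G ×-dec chordal? G

{-# OPTIONS --safe #-}
module Submission where

-- An induced cycle of length at least four has neither leaves nor siblings, so it survives both
-- kinds of reduction steps.
--
-- For the symmetry, let N(a, b) count the graphs of the class with s ≤ a and t ≤ b. Having s ≤ a
-- means that no a + 2 vertices are mutual siblings (a "clique" block), and t ≤ b that no vertex
-- has b + 1 leaves (a "star" block of b + 2 vertices). Count more generally graphs with coloured
-- vertices, where only vertices of colour 0 may form forbidden blocks. Contracting the blocks of n
-- vertices of one kind to single vertices of a fresh colour is a bijection between all graphs and
-- the graphs without such blocks that may use the fresh colour; whether a clique or a star is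
-- contracted, n vertices of colour 0 become one vertex. So forbidding clique blocks and forbidding
-- star blocks of n vertices satisfy the same recursion, and since clique blocks and star blocks of
-- different sizes are disjoint the same holds for both kinds together: N(a, b) = N(b, a).

open import Defs
open import Data.List.Base using (List)
open import Data.Nat.Base using (ℕ; _≤_)
open import Data.Product.Base using (_×_)
open import Function.Bundles using (_⇔_)
open import Relation.Nullary.Negation using (¬_)

import Algebra.Properties.CommutativeSemigroup as CommutativeSemigroup
open import Data.Bool.Base using (Bool; true; false; T; _∨_; _∧_; not; if_then_else_)
open import Data.Bool.Properties using (T-irrelevant; T-≡; T-∧; T-∨; ∧-identityʳ; ∧-zeroʳ)
open import Data.Empty using (⊥; ⊥-elim; ⊥-elim-irr)
open import Data.Fin.Base as Fin using (Fin; zero; suc)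
import Data.Fin.Properties as Fin
open import Data.Fin.Subset using (⁅_⁆; ∣_∣) renaming (_∈_ to _∈ₛ_)
open import Data.Fin.Subset.Properties using (x∈⁅x⁆; x∈⁅y⁆⇒x≡y; x∈p∪q⁺; x∈p∪q⁻; ⊆-antisym)
open import Data.List.Base as List using ([]; _∷_; _++_; length; lookup)
open import Data.List.Membership.Propositional using (_∈_; find; lose)
open import Data.List.Membership.Propositional.Properties using (∈-lookup; ∈-allFin; ∈-cartesianProduct⁺; ∈-cartesianProductWith⁺; ∈-filter⁺; ∈-filter⁻)
import Data.List.Properties as List
open import Data.List.Relation.Unary.All as All using (All; []; _∷_)
import Data.List.Relation.Unary.All.Properties as All
open import Data.List.Relation.Unary.AllPairs as AllPairs using (AllPairs; []; _∷_)
import Data.List.Relation.Unary.AllPairs.Properties as AllPairs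
open import Data.List.Relation.Unary.Any as Any using (Any; here; there)
import Data.List.Relation.Unary.Any.Properties as Any
open import Data.Nat.Base using (zero; suc; _+_; _^_; _<_; _≡ᵇ_; _≤ᵇ_; _<ᵇ_; z≤n; s≤s)
open import Data.Nat.ListAction using (sum)
import Data.Nat.Properties as ℕ
open import Data.Product.Base using (Σ; ∃; ∃₂; _,_; proj₁; proj₂)
open import Data.Product.Function.Dependent.Propositional using (Σ-↔)
open import Data.Sum.Base using (_⊎_; inj₁; inj₂)
open import Data.Unit.Base using (⊤; tt)
open import Data.Vec.Base using (tabulate)
open import Data.Vec.Properties using (lookup∘tabulate; lookup⇒[]=; []=⇒lookup)
open import Function.Base using (_∘_; id; case_of_)
open import Function.Bundles using (mk⇔; _↔_; mk↔ₛ′; Inverse; Equivalence)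
open import Function.Construct.Composition using (_↔-∘_)
open import Function.Construct.Identity using (↔-id)
open import Function.Construct.Symmetry using (↔-sym)
open import Level using (Level)
open import Relation.Binary.Construct.Closure.ReflexiveTransitive using (Star; ε; _◅_; _◅◅_; gmap; reverse)
open import Relation.Binary.Definitions using (DecidableEquality)
open import Relation.Binary.PropositionalEquality
open import Relation.Binary.PropositionalEquality.WithK using (≡-irrelevant)
open import Relation.Nullary.Decidable using (Dec; yes; no; does; map′; decidable-stable; ¬¬-excluded-middle; _×-dec_; T?)
open import Relation.Nullary.Negation using (contradiction)

-- Contraction lowers the number of vertices, so the invariant is a total weight: `spread` gives a
-- vertex of the fresh colour the weight of the n = 2 + r vertices that it replaces. It depends on r
-- alone and not on the kind of block, so both kinds of contraction lead to the same weighted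
-- classes.
--
-- The obstacle is that blocks overlap: any n vertices of a larger set of mutual siblings form one,
-- and so does a centre with any n - 1 of its leaves. Contraction depends on choices; only its
-- inverse, expansion, is a function. Its injectivity up to isomorphism rests on automorphisms that
-- carry one of two meeting blocks onto the other. The delicate case is a component with a single
-- edge: either end may serve as centre, and the edge is a clique block and a star block at once.
-- Hence the two sizes are taken to be different when both kinds are forbidden; for equal sizes the
-- symmetry is trivial.
--
-- Edges and classes are undecidable here, but the claims are equalities of lengths. These are
-- stable under double negation, so excluded middle may be used on the way.

private variable
  p q : Level
  A : Set p
  B : Set q
  k ℓ m n r s : ℕ

-- Double negation, coloured graphs and counting up to isomorphism

return : A → ¬ ¬ A
return x ¬x = ¬x x

infixl 1 _>>=_
_>>=_ : ¬ ¬ A → (A → ¬ ¬ B) → ¬ ¬ B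
(m >>= f) ¬b = m λ x → f x ¬b

-- Double negation shift, valid over a finite index set. It serves as choice: one witness or one
-- decision for every vertex, or for every pair.
¬¬-∀Fin : {P : Fin n → Set p} → (∀ i → ¬ ¬ P i) → ¬ ¬ (∀ i → P i)
¬¬-∀Fin {n = zero}  h = return λ ()
¬¬-∀Fin {n = suc n} h = do
  p₀ ← h zero
  ps ← ¬¬-∀Fin (h ∘ suc)
  return λ { zero → p₀ ; (suc i) → ps i }

-- The vertices form an arbitrary set, so that expansions and contractions can be built from pairs
-- and subsets without renumbering.
record ColouredGraph : Set₁ where
  infix 4 _≟_
  field
    V           : Set
    _≟_         : DecidableEquality V
    Edge        : V → V → Set
    edge-sym    : ∀ {u v} → Edge u v → Edge v u
    edge-irrefl : ∀ {v} → ¬ Edge v v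
    colour      : V → ℕ

open ColouredGraph using (V; Edge; edge-sym; edge-irrefl; colour)

private variable
  X Y Z Y′ : ColouredGraph

record Iso (X Y : ColouredGraph) : Set where
  field
    to        : V X → V Y
    from      : V Y → V X
    from-to   : ∀ v → from (to v) ≡ v
    to-from   : ∀ v → to (from v) ≡ v
    edge⁺     : ∀ {u v} → Edge X u v → Edge Y (to u) (to v)
    edge⁻     : ∀ {u v} → Edge Y (to u) (to v) → Edge X u v
    colour-to : ∀ v → colour Y (to v) ≡ colour X v

  to-injective : ∀ {u v} → to u ≡ to v → u ≡ v
  to-injective {u} {v} eq = trans (sym (from-to u)) (trans (cong from eq) (from-to v))

  colour-from : ∀ v → colour X (from v) ≡ colour Y v
  colour-from v = trans (sym (colour-to (from v))) (cong (colour Y) (to-from v))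

iso-refl : Iso X X
iso-refl = record
  { to = id ; from = id ; from-to = λ _ → refl ; to-from = λ _ → refl
  ; edge⁺ = id ; edge⁻ = id ; colour-to = λ _ → refl }

iso-sym : Iso X Y → Iso Y X
iso-sym {Y = Y} f = record
  { to = from ; from = to ; from-to = to-from ; to-from = from-to
  ; edge⁺ = λ {u} {v} e → edge⁻ (subst₂ (Edge Y) (sym (to-from u)) (sym (to-from v)) e)
  ; edge⁻ = λ {u} {v} e → subst₂ (Edge Y) (to-from u) (to-from v) (edge⁺ e)
  ; colour-to = colour-from }
  where open Iso f

iso-trans : Iso X Y → Iso Y Z → Iso X Z
iso-trans f g = record
  { to = G.to ∘ F.to ; from = F.from ∘ G.from
  ; from-to = λ v → trans (cong F.from (G.from-to (F.to v))) (F.from-to v)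
  ; to-from = λ v → trans (cong G.to (F.to-from (G.from v))) (G.to-from v)
  ; edge⁺ = G.edge⁺ ∘ F.edge⁺ ; edge⁻ = F.edge⁻ ∘ G.edge⁻
  ; colour-to = λ v → trans (G.colour-to (F.to v)) (F.colour-to v) }
  where
  module F = Iso f
  module G = Iso g

-- A list of representatives of the isomorphism classes satisfying P, complete up to double
-- negation: it then exists for undecidable P too, and its length is still determined by P.
record Reps (P : ColouredGraph → Set) (xs : List ColouredGraph) : Set₁ where
  field
    sound    : All P xs
    distinct : AllPairs (λ X Y → ¬ Iso X Y) xs
    complete : ∀ X → P X → ¬ ¬ Any (Iso X) xs

AllPairs-lookup : {xs : List ColouredGraph} → AllPairs (λ X Y → ¬ Iso X Y) xs →
                  ∀ i j → ¬ ¬ Iso (lookup xs i) (lookup xs j) → i ≡ j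
AllPairs-lookup (_ ∷ _)  zero    zero    _ = refl
AllPairs-lookup (p ∷ _)  zero    (suc j) h = contradiction (All.lookup p (∈-lookup j)) h
AllPairs-lookup (p ∷ _)  (suc i) zero    h =
  contradiction (All.lookup p (∈-lookup i) ∘ iso-sym) h
AllPairs-lookup (_ ∷ ps) (suc i) (suc j) h = cong suc (AllPairs-lookup ps i j h)

-- Partners under `R` exist only up to double negation. Choosing them for all positions at once
-- yields an injection of positions, and the decidability of `≤` removes the double negation.
length≤ : (R : ColouredGraph → ColouredGraph → Set) {xs ys : List ColouredGraph} →
          AllPairs (λ X Y → ¬ Iso X Y) xs →
          All (λ X → ¬ ¬ Any (R X) ys) xs →
          (∀ {X X′ Y} → R X Y → R X′ Y → ¬ ¬ Iso X X′) →
          length xs ≤ length ys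
length≤ R {xs} {ys} distinct total injective = decidable-stable (length xs ℕ.≤? length ys) do
  f ← ¬¬-∀Fin (λ i → All.lookup total (∈-lookup {xs = xs} i))
  return (Fin.injective⇒≤ {f = λ i → Any.index (f i)} λ {i} {j} eq →
    AllPairs-lookup distinct i j (injective (Any.lookup-index (f i))
      (subst (λ k → R (lookup xs j) (lookup ys k)) (sym eq) (Any.lookup-index (f j)))))

length-bijection :
  {P Q : ColouredGraph → Set} (f : ColouredGraph → ColouredGraph) →
  (∀ {Y} → Q Y → P (f Y)) →
  (∀ {Y Y′} → Iso Y Y′ → Iso (f Y) (f Y′)) →
  (∀ {Y Y′} → Q Y → Q Y′ → Iso (f Y) (f Y′) → ¬ ¬ Iso Y Y′) →
  (∀ {X} → P X → ¬ ¬ ∃ λ Y → Q Y × Iso X (f Y)) →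
  ∀ {xs ys} → Reps P xs → Reps Q ys → length xs ≡ length ys
length-bijection {P} {Q} f maps cong-f injective surjective reps-xs reps-ys = ℕ.≤-antisym
  (length≤ (λ X Y → Iso X (f Y)) X.distinct
    (All.map (λ p → do
      Y , q , X≅fY ← surjective p
      found ← Y.complete Y q
      return (Any.map (λ Y≅Y′ → iso-trans X≅fY (cong-f Y≅Y′)) found)) X.sound)
    (λ f g → return (iso-trans f (iso-sym g))))
  (length≤ (λ Y X → Q Y × Iso (f Y) X) Y.distinct
    (All.map (λ {Y} q → do
      found ← X.complete (f Y) (maps q)
      return (Any.map (q ,_) found)) Y.sound)
    (λ { (q , i) (q′ , i′) → injective q q′ (iso-trans i (iso-sym i′)) }))
  where
  module X = Reps reps-xs
  module Y = Reps reps-ys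

-- Greedy selection: a candidate is kept if it satisfies `P` and resembles no graph kept so far. A
-- discarded candidate isomorphic to some `X` with `P X` satisfies `P` by `resp`, so a graph
-- isomorphic to it was kept already.
reps-exist : {P : ColouredGraph → Set} → (∀ {X Y} → Iso X Y → P X → P Y) →
             ∀ cs → (∀ X → P X → ¬ ¬ Any (Iso X) cs) → ¬ ¬ ∃ (Reps P)
reps-exist {P} resp cs cover = do
  xs , sound , distinct , complete ← go cs
  return (xs , record { sound = sound ; distinct = distinct ; complete = λ X p →
    cover X p >>= complete X p })
  where
  go : ∀ cs → ¬ ¬ ∃ λ xs → All P xs × AllPairs (λ X Y → ¬ Iso X Y) xs ×
                            (∀ X → P X → Any (Iso X) cs → ¬ ¬ Any (Iso X) xs)
  go [] = return ([] , [] , [] , λ _ _ ())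
  go (c ∷ cs) = do
    xs , sound , distinct , complete ← go cs
    yes (p , new) ← ¬¬-excluded-middle {A = P c × All (λ X → ¬ Iso c X) xs}
      where no ¬new → return (xs , sound , distinct , λ
              { X p (here X≅c) → ¬¬-excluded-middle >>= λ
                  { (yes found) → return found
                  ; (no ¬found) → λ _ → ¬new (resp X≅c p ,
                      All.¬Any⇒All¬ xs (¬found ∘ Any.map (iso-trans X≅c))) }
              ; X p (there found) → complete X p found })
    return (c ∷ xs , p ∷ sound , new ∷ distinct , λ
      { X p (here X≅c)    → return (here X≅c)
      ; X p (there found) → complete X p found >>= return ∘ there })

reps-++ : {P Q R : ColouredGraph → Set} → (∀ {X Y} → Iso X Y → Q X → Q Y) →
          (∀ {X} → Q X → P X) → (∀ {X} → R X → P X) → (∀ {X} → P X → ¬ ¬ (Q X ⊎ R X)) →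
          (∀ {X} → Q X → ¬ R X) →
          ∀ {xs ys} → Reps Q xs → Reps R ys → Reps P (xs ++ ys)
reps-++ resp Q⊆P R⊆P split disjoint {xs} reps-xs reps-ys = record
  { sound = All.++⁺ (All.map Q⊆P X.sound) (All.map R⊆P Y.sound)
  ; distinct = AllPairs.++⁺ X.distinct Y.distinct
      (All.map (λ q → All.map (λ r X≅Y → disjoint (resp X≅Y q) r) Y.sound) X.sound)
  ; complete = λ X p → split p >>= λ
      { (inj₁ q) → X.complete X q >>= return ∘ Any.++⁺ˡ
      ; (inj₂ r) → Y.complete X r >>= return ∘ Any.++⁺ʳ xs } }
  where
  module X = Reps reps-xs
  module Y = Reps reps-ys

-- Gadgets, blocks and expansion

-- A graph on 2 + r vertices, some of which may be joined to the outside.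
record Gadget (r : ℕ) : Set₁ where
  field
    Inner        : Fin (2 + r) → Fin (2 + r) → Set
    inner-sym    : ∀ {i j} → Inner i j → Inner j i
    inner-irrefl : ∀ {i} → ¬ Inner i i
    inner-centre : ∀ i → Inner zero (suc i)
    Port         : Fin (2 + r) → Set
    port-centre  : Port zero

module _ (g : Gadget r) where
  open Gadget g

  -- A copy of the gadget on vertices of colour 0, whose ports all have the outside neighbours of vertex zero.
  record Block (X : ColouredGraph) (e : Fin (2 + r) → V X) : Set where
    field
      injective   : ∀ {i j} → e i ≡ e j → i ≡ j
      colour-zero : ∀ i → colour X (e i) ≡ 0
      inner⁺      : ∀ {i j} → Inner i j → Edge X (e i) (e j)
      inner⁻      : ∀ {i j} → Edge X (e i) (e j) → Inner i j
      outer⁺      : ∀ {w} → (∀ j → w ≢ e j) → ∀ {i} → Port i → Edge X w (e zero) → Edge X w (e i)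
      outer⁻      : ∀ {w} → (∀ j → w ≢ e j) → ∀ {i} → Edge X w (e i) → Port i × Edge X w (e zero)

  Free : ColouredGraph → Set
  Free X = ∀ e → ¬ Block X e

  block-cong : ∀ {e e′} → (∀ i → e i ≡ e′ i) → Block X e → Block X e′
  block-cong {X} eq b = record
    { injective = λ {i} {j} p → injective (trans (eq i) (trans p (sym (eq j))))
    ; colour-zero = λ i → trans (cong (colour X) (sym (eq i))) (colour-zero i)
    ; inner⁺ = λ {i} {j} p → subst₂ (Edge X) (eq i) (eq j) (inner⁺ p)
    ; inner⁻ = λ {i} {j} p → inner⁻ (subst₂ (Edge X) (sym (eq i)) (sym (eq j)) p)
    ; outer⁺ = λ {w} out {i} p d → subst (Edge X w) (eq i)
        (outer⁺ (λ j q → out j (trans q (eq j))) p (subst (Edge X w) (sym (eq zero)) d))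
    ; outer⁻ = λ {w} out {i} d → case outer⁻ (λ j q → out j (trans q (eq j))) (subst (Edge X w) (sym (eq i)) d) of
        λ (p , d′) → p , subst (Edge X w) (eq zero) d′
    }
    where open Block b

  block-iso : (f : Iso X Y) → ∀ {e} → Block X e → Block Y (Iso.to f ∘ e)
  block-iso {X} {Y} f {e} b = record
    { injective = injective ∘ to-injective
    ; colour-zero = λ i → trans (colour-to (e i)) (colour-zero i)
    ; inner⁺ = edge⁺ ∘ inner⁺
    ; inner⁻ = inner⁻ ∘ edge⁻
    ; outer⁺ = λ {w} out p d → push (outer⁺ (pull-out out) p (pull d))
    ; outer⁻ = λ {w} out d → case outer⁻ (pull-out out) (pull d) of λ (p , d′) → p , push d′
    }
    where
    open Block b
    open Iso f
    pull-out : ∀ {w} → (∀ j → w ≢ to (e j)) → ∀ j → from w ≢ e j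
    pull-out {w} out j eq = out j (trans (sym (to-from w)) (cong to eq))
    pull : ∀ {w v} → Edge Y w (to v) → Edge X (from w) v
    pull {w} {v} d = edge⁻ (subst (λ w → Edge Y w (to v)) (sym (to-from w)) d)
    push : ∀ {w v} → Edge X (from w) v → Edge Y w (to v)
    push {w} {v} d = subst (λ w → Edge Y w (to v)) (to-from w) (edge⁺ d)

  free-iso : Iso X Y → Free X → Free Y
  free-iso f free e b = free _ (block-iso (iso-sym f) b)

-- Describing an isomorphism by its graph lets edges and colours be treated by matching on `R`,
-- without unfolding the functions.
relation⇒iso : (R : V X → V Y → Set) →
               (∀ x → ∃ (R x)) → (∀ y → ∃ λ x → R x y) →
               (∀ {x y y′} → R x y → R x y′ → y ≡ y′) → (∀ {x x′ y} → R x y → R x′ y → x ≡ x′) →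
               (∀ {x x′ y y′} → R x y → R x′ y′ → Edge X x x′ → Edge Y y y′) →
               (∀ {x x′ y y′} → R x y → R x′ y′ → Edge Y y y′ → Edge X x x′) →
               (∀ {x y} → R x y → colour Y y ≡ colour X x) → Iso X Y
relation⇒iso R right left right! left! edge⁺ edge⁻ colour-to = record
  { to = proj₁ ∘ right ; from = proj₁ ∘ left
  ; from-to = λ v → left! (proj₂ (left _)) (proj₂ (right v))
  ; to-from = λ v → right! (proj₂ (right _)) (proj₂ (left v))
  ; edge⁺ = edge⁺ (proj₂ (right _)) (proj₂ (right _))
  ; edge⁻ = edge⁻ (proj₂ (right _)) (proj₂ (right _))
  ; colour-to = λ v → colour-to (proj₂ (right v))
  }

recolour : (X : ColouredGraph) → (V X → ℕ) → ColouredGraph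
recolour X c = record { ColouredGraph X ; colour = c }

-- Whether the i-th copy of a vertex of colour c exists in expand: copy zero always, the others for c = k.
Expanding : ℕ → ℕ → Fin (suc n) → Set
Expanding k c zero    = ⊤
Expanding k c (suc _) = T (c ≡ᵇ k)

-- The colour that expansion gives to all copies of a vertex: copies of an expanded vertex become
-- ordinary vertices of colour 0.
erase : ℕ → ℕ → ℕ
erase k c with c ℕ.≟ k
... | yes _ = 0
... | no _  = c

module _ {k : ℕ} where

  expanding-irrelevant : ∀ {c} (i : Fin (suc n)) (p q : Expanding k c i) → p ≡ q
  expanding-irrelevant zero    p q = refl
  expanding-irrelevant (suc _) p q = T-irrelevant p q

  expanding-≢ : ∀ {c} (i : Fin (suc n)) → c ≢ k → Expanding k c i → i ≡ zero
  expanding-≢ zero    c≢k p = refl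
  expanding-≢ {c = c} (suc _) c≢k p = contradiction (ℕ.≡ᵇ⇒≡ c k p) c≢k

  expanding-≡ : ∀ {c} → c ≡ k → (i : Fin (suc n)) → Expanding k c i
  expanding-≡ c≡k zero = tt
  expanding-≡ {c = c} c≡k (suc i) = ℕ.≡⇒≡ᵇ c k c≡k

  expanding-map : ∀ {c c′} (i : Fin (suc n)) → (c ≡ k → c′ ≡ k) → Expanding k c i → Expanding k c′ i
  expanding-map zero            f p = tt
  expanding-map {c = c} (suc i) f p = expanding-≡ (f (ℕ.≡ᵇ⇒≡ c k p)) (suc i)

  erase-≡ : ∀ {c} → c ≡ k → erase k c ≡ 0
  erase-≡ {c} c≡k with c ℕ.≟ k
  ... | yes _  = refl
  ... | no c≢k = contradiction c≡k c≢k

  erase-≢ : ∀ {c} → c ≢ k → erase k c ≡ c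
  erase-≢ {c} c≢k with c ℕ.≟ k
  ... | yes c≡k = contradiction c≡k c≢k
  ... | no _    = refl

module Expansion (g : Gadget r) (k : ℕ) where
  open Gadget g

  Copy : ColouredGraph → Set
  Copy Y = Σ (V Y) λ y → Σ (Fin (2 + r)) (Expanding k (colour Y y))

  copy-≡ : ∀ {y y′ i i′ a a′} → y ≡ y′ → i ≡ i′ → _≡_ {A = Copy Y} (y , i , a) (y′ , i′ , a′)
  copy-≡ {y = y} {i = i} refl refl = cong (λ a → y , i , a) (expanding-irrelevant i _ _)

  -- Outside edges attach to the ports: to every copy for a clique, to the centre alone for a star.
  -- An unexpanded vertex has only copy zero, which is a port, and so keeps its edges.
  expand : ColouredGraph → ColouredGraph
  expand Y = record
    { V = Copy Y
    ; _≟_ = λ (y , i , _) (y′ , i′ , _) →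
        map′ (λ (p , q) → copy-≡ {Y = Y} p q) (λ { refl → refl , refl })
             ((y Y.≟ y′) ×-dec (i Fin.≟ i′))
    ; Edge = λ (y , i , _) (y′ , i′ , _) →
        (y ≡ y′ × Inner i i′) ⊎ (Port i × Port i′ × Edge Y y y′)
    ; edge-sym = λ { (inj₁ (p , q)) → inj₁ (sym p , inner-sym q)
                   ; (inj₂ (p , q , d)) → inj₂ (q , p , edge-sym Y d) }
    ; edge-irrefl = λ { (inj₁ (_ , q)) → inner-irrefl q ; (inj₂ (_ , _ , d)) → edge-irrefl Y d }
    ; colour = λ (y , _) → erase k (colour Y y)
    }
    where module Y = ColouredGraph Y

  expand-iso : Iso X Y → Iso (expand X) (expand Y)
  expand-iso {X} {Y} f = relation⇒iso (λ (x , i , _) (y , j , _) → to x ≡ y × i ≡ j)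
    (λ (x , i , a) → (to x , i , expanding-map i (trans (colour-to x)) a) , refl , refl)
    (λ (y , i , a) → (from y , i , expanding-map i (trans (colour-from y)) a) , to-from y , refl)
    (λ { (refl , refl) (refl , refl) → copy-≡ {Y = Y} refl refl })
    (λ { (p , refl) (q , refl) → copy-≡ {Y = X} (to-injective (trans p (sym q))) refl })
    (λ { (refl , refl) (refl , refl) (inj₁ (p , q)) → inj₁ (cong to p , q)
       ; (refl , refl) (refl , refl) (inj₂ (p , q , d)) → inj₂ (p , q , edge⁺ d) })
    (λ { (refl , refl) (refl , refl) (inj₁ (p , q)) → inj₁ (to-injective p , q)
       ; (refl , refl) (refl , refl) (inj₂ (p , q , d)) → inj₂ (p , q , edge⁻ d) })
    (λ { {x , _} (refl , refl) → cong (erase k) (colour-to x) })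
    where open Iso f

  expand-unmarked : (∀ y → colour Y y ≢ k) → Iso Y (expand Y)
  expand-unmarked {Y} ≢k = relation⇒iso (λ y (y′ , _) → y ≡ y′)
    (λ y → (y , zero , tt) , refl)
    (λ (y , _) → y , refl)
    (λ { {y} {_ , i , a} {_ , j , b} refl refl → copy-≡ {Y = Y} refl (trans (centre {y} i a) (sym (centre {y} j b))) })
    (λ { refl refl → refl })
    (λ { {y} {y′} {_ , i , a} {_ , j , b} refl refl d → inj₂ (port {y} i a , port {y′} j b , d) })
    (λ { {y} {_} {_ , i , a} {_ , j , b} refl refl (inj₁ (refl , d)) →
           contradiction (subst₂ Inner (centre {y} i a) (centre {y} j b) d) inner-irrefl
       ; refl refl (inj₂ (_ , _ , d)) → d })
    (λ { {y} refl → erase-≢ (≢k y) })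
    where
    centre : ∀ {y} i → Expanding k (colour Y y) i → i ≡ zero
    centre {y} i = expanding-≢ i (≢k y)
    port : ∀ {y} i → Expanding k (colour Y y) i → Port i
    port {y} i a = subst Port (sym (centre {y} i a)) port-centre

  copies : ∀ {y} → colour Y y ≡ k → Fin (2 + r) → Copy Y
  copies {y = y} eq i = y , i , expanding-≡ eq i

  copies-block : ∀ {y} (eq : colour Y y ≡ k) → Block g (expand Y) (copies {Y = Y} eq)
  copies-block {Y} {y} eq = record
    { injective = λ { refl → refl }
    ; colour-zero = λ _ → erase-≡ eq
    ; inner⁺ = λ d → inj₁ (refl , d)
    ; inner⁻ = λ { (inj₁ (_ , d)) → d ; (inj₂ (_ , _ , d)) → contradiction d (edge-irrefl Y) }
    ; outer⁺ = λ { out p (inj₁ (refl , _)) → contradiction (copy-≡ {Y = Y} refl refl) (out _)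
                 ; out p (inj₂ (q , _ , d)) → inj₂ (q , p , d) }
    ; outer⁻ = λ { out (inj₁ (refl , _)) → contradiction (copy-≡ {Y = Y} refl refl) (out _)
                 ; out (inj₂ (q , p , d)) → p , inj₂ (q , port-centre , d) }
    }

  free-expand⇒unmarked : Free g (expand Y) → ∀ y → colour Y y ≢ k
  free-expand⇒unmarked {Y} free y eq = free _ (copies-block {Y = Y} eq)

  module _ (h : Gadget s) where

    -- Vertices of a block have colour 0, hence are not expanded, and the block survives on the
    -- copies zero.
    lift-block : k ≢ 0 → ∀ {e} → Block h Y e → Block h (expand Y) (λ i → e i , zero , tt)
    lift-block {Y} k≢0 {e} b = record
      { injective = injective ∘ cong proj₁
      ; colour-zero = λ i → trans (erase-≢ (≢k i)) (colour-zero i)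
      ; inner⁺ = λ d → inj₂ (port-centre , port-centre , inner⁺ d)
      ; inner⁻ = λ { (inj₁ (_ , d)) → contradiction d inner-irrefl ; (inj₂ (_ , _ , d)) → inner⁻ d }
      ; outer⁺ = λ { out p (inj₁ (refl , d)) → contradiction (at-centre zero) (out zero)
                   ; out p (inj₂ (q , q′ , d)) → inj₂ (q , q′ , outer⁺ (outside out) p d) }
      ; outer⁻ = λ { out {i} (inj₁ (refl , d)) → contradiction (at-centre i) (out i)
                   ; out (inj₂ (q , q′ , d)) → case outer⁻ (outside out) d of λ (p , d′) → p , inj₂ (q , q′ , d′) }
      }
      where
      open Block b
      ≢k : ∀ i → colour Y (e i) ≢ k
      ≢k i eq = k≢0 (trans (sym eq) (colour-zero i))
      at-centre : ∀ i {j a} → _≡_ {A = Copy Y} (e i , j , a) (e i , zero , tt)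
      at-centre i {j} {a} = copy-≡ {Y = Y} refl (expanding-≢ j (≢k i) a)
      outside : ∀ {w} → (∀ j → w ≢ (e j , zero , tt)) → ∀ j → proj₁ w ≢ e j
      outside out j refl = out j (at-centre j)

    lower-block : ∀ {e} → (∀ i → colour Y (proj₁ (e i)) ≢ k) →
                  Block h (expand Y) e → Block h Y (proj₁ ∘ e)
    lower-block {Y} {e} ≢k b = record
      { injective = λ p → injective (copy-≡ {Y = Y} p refl)
      ; colour-zero = λ i → trans (sym (erase-≢ (≢k i))) (colour-zero i)
      ; inner⁺ = λ d → project (inner⁺ d)
      ; inner⁻ = λ d → inner⁻ (inj₂ (port-centre , port-centre , d))
      ; outer⁺ = λ out p d → project (outer⁺ {_ , zero , tt} (outside out) p (inj₂ (port-centre , port-centre , d)))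
      ; outer⁻ = λ out d → case outer⁻ {_ , zero , tt} (outside out) (inj₂ (port-centre , port-centre , d)) of
          λ (p , d′) → p , project d′
      }
      where
      open Block (block-cong h {e′ = λ i → proj₁ (e i) , zero , tt}
        (λ i → copy-≡ {Y = Y} refl (expanding-≢ (proj₁ (proj₂ (e i))) (≢k i) (proj₂ (proj₂ (e i))))) b)
      outside : ∀ {w} → (∀ j → w ≢ proj₁ (e j)) → ∀ j → (w , zero , tt) ≢ (proj₁ (e j) , zero , tt)
      outside out j p = out j (cong proj₁ p)
      project : ∀ {u v a b} → Edge (expand Y) (u , zero , a) (v , zero , b) → Edge Y u v
      project (inj₁ (_ , d)) = contradiction d inner-irrefl
      project (inj₂ (_ , _ , d)) = d

  module Merge (X : ColouredGraph) {e : Fin (2 + r) → V X} (b : Block g X e) (k≢0 : k ≢ 0) where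
    open ColouredGraph X using (_≟_)
    open Block b

    -- The vertex `e zero` stands for the merged block. As `outside` is irrelevant, kept vertices
    -- are equal as soon as their underlying vertices are.
    record Kept : Set where
      constructor kept
      field
        vertex   : V X
        .outside : ∀ i → vertex ≢ e (suc i)
    open Kept

    kept-≡ : ∀ {x y} → vertex x ≡ vertex y → x ≡ y
    kept-≡ refl = refl

    mergedColour : V X → ℕ
    mergedColour v with v ≟ e zero
    ... | yes _ = k
    ... | no _  = colour X v

    mergedColour-≡ : ∀ {v} → v ≡ e zero → mergedColour v ≡ k
    mergedColour-≡ {v} eq with v ≟ e zero
    ... | yes _ = refl
    ... | no ≢e = contradiction eq ≢e

    mergedColour-≢ : ∀ {v} → v ≢ e zero → mergedColour v ≡ colour X v
    mergedColour-≢ {v} ≢e with v ≟ e zero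
    ... | yes eq = contradiction eq ≢e
    ... | no _   = refl

    merged : ColouredGraph
    merged = record
      { V = Kept
      ; _≟_ = λ x y → map′ kept-≡ (cong vertex) (vertex x ≟ vertex y)
      ; Edge = λ x y → Edge X (vertex x) (vertex y)
      ; edge-sym = edge-sym X
      ; edge-irrefl = edge-irrefl X
      ; colour = λ x → mergedColour (vertex x)
      }

    private
      -- A vertex `e i` of the block corresponds to the copy `i` of the merged vertex; everything
      -- outside the block corresponds to itself.
      R : Copy X → Copy merged → Set
      R (v , i , _) (v′ , i′ , _) =
        (v ≡ e i′ × vertex v′ ≡ e zero) ⊎ ((∀ j → v ≢ e j) × vertex v′ ≡ v × i ≡ i′)

      e-unmarked : ∀ {i} → colour X (e i) ≢ k
      e-unmarked {i} eq = k≢0 (trans (sym eq) (colour-zero i))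

      outside-all : ∀ {v} → v ≢ e zero → (∀ i → v ≢ e (suc i)) → ∀ j → v ≢ e j
      outside-all ≢e out zero    = ≢e
      outside-all ≢e out (suc j) = out j

      right : ∀ x → ∃ (R x)
      right (v , i , a) with Fin.any? (λ j → v ≟ e j)
      ... | yes (j , eq) = (kept (e zero) (λ i p → case injective p of λ ()) , j ,
              expanding-≡ (mergedColour-≡ refl) j) , inj₁ (eq , refl)
      ... | no out = (kept v (λ j p → out (suc j , p)) , i ,
              expanding-map i (trans (mergedColour-≢ (λ p → out (zero , p)))) a) ,
              inj₂ ((λ j p → out (j , p)) , refl , refl)

      left : ∀ y → ∃ λ x → R x y
      left (kept v out , i , a) with v ≟ e zero
      ... | yes eq = (e i , zero , tt) , inj₁ (refl , eq)
      ... | no ≢e  = (v , i , a) ,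
              inj₂ (outside-all ≢e (λ j p → ⊥-elim-irr (out j p)) , refl , refl)

      right! : ∀ {x y y′} → R x y → R x y′ → y ≡ y′
      right! (inj₁ (p , q)) (inj₁ (p′ , q′)) =
        copy-≡ {Y = merged} (kept-≡ (trans q (sym q′))) (injective (trans (sym p) p′))
      right! (inj₁ (p , _)) (inj₂ (out , _)) = contradiction p (out _)
      right! (inj₂ (out , _)) (inj₁ (p , _)) = contradiction p (out _)
      right! (inj₂ (_ , q , refl)) (inj₂ (_ , q′ , refl)) =
        copy-≡ {Y = merged} (kept-≡ (trans q (sym q′))) refl

      left! : ∀ {x x′ y} → R x y → R x′ y → x ≡ x′
      left! {_ , i , a} {_ , i′ , a′} (inj₁ (refl , _)) (inj₁ (refl , _)) =
        copy-≡ {Y = X} refl (trans (expanding-≢ i e-unmarked a) (sym (expanding-≢ i′ e-unmarked a′)))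
      left! (inj₁ (_ , q)) (inj₂ (out , q′ , _)) = contradiction (trans (sym q′) q) (out zero)
      left! (inj₂ (out , q′ , _)) (inj₁ (_ , q)) = contradiction (trans (sym q′) q) (out zero)
      left! (inj₂ (_ , refl , refl)) (inj₂ (_ , refl , refl)) = copy-≡ {Y = X} refl refl

      centre : ∀ j (i : Fin (2 + r)) → Expanding k (colour X (e j)) i → i ≡ zero
      centre j i = expanding-≢ i e-unmarked

      port : ∀ j (i : Fin (2 + r)) → Expanding k (colour X (e j)) i → Port i
      port j i a = subst Port (sym (centre j i a)) port-centre

      preserves : ∀ {x x′ y y′} → R x y → R x′ y′ → Edge (expand X) x x′ → Edge (expand merged) y y′
      preserves {_ , i , a} {_ , i′ , a′} {_ , j , _} {_ , j′ , _} (inj₁ (refl , q)) (inj₁ (refl , q′)) (inj₁ (_ , d)) =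
        contradiction (subst₂ Inner (centre j i a) (centre j′ i′ a′) d) inner-irrefl
      preserves (inj₁ (refl , q)) (inj₁ (refl , q′)) (inj₂ (_ , _ , d)) =
        inj₁ (kept-≡ (trans q (sym q′)) , inner⁻ d)
      preserves (inj₁ (refl , q)) (inj₂ (out , _)) (inj₁ (p , _)) = contradiction (sym p) (out _)
      preserves (inj₁ (refl , q)) (inj₂ (out , q′ , refl)) (inj₂ (_ , p , d)) =
        case outer⁻ out (edge-sym X d) of λ (p′ , d′) →
          inj₂ (p′ , p , subst₂ (Edge X) (sym q) (sym q′) (edge-sym X d′))
      preserves (inj₂ (out , _)) (inj₁ (refl , q)) (inj₁ (p , _)) = contradiction p (out _)
      preserves (inj₂ (out , q′ , refl)) (inj₁ (refl , q)) (inj₂ (p , _ , d)) =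
        case outer⁻ out d of λ (p′ , d′) →
          inj₂ (p , p′ , subst₂ (Edge X) (sym q′) (sym q) d′)
      preserves (inj₂ (_ , q , refl)) (inj₂ (_ , q′ , refl)) (inj₁ (p , d)) =
        inj₁ (kept-≡ (trans q (trans p (sym q′))) , d)
      preserves (inj₂ (_ , q , refl)) (inj₂ (_ , q′ , refl)) (inj₂ (p , p′ , d)) =
        inj₂ (p , p′ , subst₂ (Edge X) (sym q) (sym q′) d)

      reflects : ∀ {x x′ y y′} → R x y → R x′ y′ → Edge (expand merged) y y′ → Edge (expand X) x x′
      reflects {_ , i , a} {_ , i′ , a′} {_ , j , _} {_ , j′ , _} (inj₁ (refl , q)) (inj₁ (refl , q′)) (inj₁ (_ , d)) =
        inj₂ (port j i a , port j′ i′ a′ , inner⁺ d)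
      reflects (inj₁ (refl , q)) (inj₁ (refl , q′)) (inj₂ (_ , _ , d)) =
        contradiction (subst₂ (Edge X) q q′ d) (edge-irrefl X)
      reflects (inj₁ (refl , q)) (inj₂ (out , q′ , refl)) (inj₁ (p , _)) =
        contradiction (trans (sym q′) (trans (cong vertex (sym p)) q)) (out zero)
      reflects {_ , i , a} {y = _ , j , _} (inj₁ (refl , q)) (inj₂ (out , q′ , refl)) (inj₂ (p , p′ , d)) =
        inj₂ (port j i a , p′ ,
              edge-sym X (outer⁺ out p (edge-sym X (subst₂ (Edge X) q q′ d))))
      reflects (inj₂ (out , q′ , refl)) (inj₁ (refl , q)) (inj₁ (p , _)) =
        contradiction (trans (sym q′) (trans (cong vertex p) q)) (out zero)
      reflects {x′ = _ , i , a} {y′ = _ , j , _} (inj₂ (out , q′ , refl)) (inj₁ (refl , q)) (inj₂ (p , p′ , d)) =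
        inj₂ (p , port j i a ,
              outer⁺ out p′ (subst₂ (Edge X) q′ q d))
      reflects (inj₂ (_ , q , refl)) (inj₂ (_ , q′ , refl)) (inj₁ (p , d)) =
        inj₁ (trans (sym q) (trans (cong vertex p) q′) , d)
      reflects (inj₂ (_ , q , refl)) (inj₂ (_ , q′ , refl)) (inj₂ (p , p′ , d)) =
        inj₂ (p , p′ , subst₂ (Edge X) q q′ d)

      colours : ∀ {x y} → R x y → erase k (mergedColour (vertex (proj₁ y))) ≡ erase k (colour X (proj₁ x))
      colours (inj₁ (refl , q)) = trans (erase-≡ (mergedColour-≡ q))
        (sym (trans (erase-≢ e-unmarked) (colour-zero _)))
      colours (inj₂ (out , refl , _)) = cong (erase k) (mergedColour-≢ (out zero))

    -- The comparison is with `expand X` and not with `X`, because after earlier merges `X` already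
    -- contains vertices of colour `k`; in this form successive merges compose.
    expand-merged : Iso (expand X) (expand merged)
    expand-merged = relation⇒iso {X = expand X} {Y = expand merged} R right left
      (λ {x} {y} {y′} → right! {x} {y} {y′}) (λ {x} {x′} {y} → left! {x} {x′} {y})
      (λ {x} {x′} {y} {y′} → preserves {x} {x′} {y} {y′})
      (λ {x} {x′} {y} {y′} → reflects {x} {x′} {y} {y′}) (λ {x} {y} → colours {x} {y})

  -- Merging a block deletes at least one vertex, so some sequence of merges ends in a block-free graph.
  normalise : k ≢ 0 → ∀ μ X (ι : V X → Fin μ) → (∀ {u v} → ι u ≡ ι v → u ≡ v) →
              ¬ ¬ ∃ λ Y → Free g Y × Iso (expand X) (expand Y)
  normalise k≢0 zero    X ι inj = return (X , (λ e _ → case ι (e zero) of λ ()) , iso-refl)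
  normalise k≢0 (suc μ) X ι inj = do
    yes (e , b) ← ¬¬-excluded-middle {A = ∃ (Block g X)}
      where no free → return (X , (λ e b → free (e , b)) , iso-refl)
    let open Merge X b k≢0
        -- The vertex `e (suc zero)` is not kept, so its number can be punched out, which lowers
        -- `μ`.
        miss : (x : Kept) → ι (e (suc zero)) ≢ ι (Kept.vertex x)
        miss = λ (kept v out) p → ⊥-elim-irr (out zero (sym (inj p)))
    Y , free , f ← normalise k≢0 μ merged (λ x → Fin.punchOut (miss x))
      (λ {x} {y} p → kept-≡ (inj (Fin.punchOut-injective (miss x) (miss y) p)))
    return (Y , free , iso-trans expand-merged f)

-- Injectivity of expansion

-- A substitute for the disjointness of blocks, which fails: whichever of two meeting blocks is
-- contracted, the results are isomorphic.
Conjugate : Gadget r → Set₁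
Conjugate g = ∀ {X e e′} → Block g X e → Block g X e′ → ∀ i j → e i ≡ e′ j →
              ∃ λ (σ : Iso X X) → ∀ i → Iso.to σ (e i) ≡ e′ i

recolour-iso : (f : Iso X Y) {c : V X → ℕ} {c′ : V Y → ℕ} → (∀ v → c′ (Iso.to f v) ≡ c v) →
               Iso (recolour X c) (recolour Y c′)
recolour-iso f eq = record { Iso f ; colour-to = eq }

module Injectivity (g : Gadget r) (k : ℕ) where
  open Gadget g
  open Expansion g k

  module _ (Y : ColouredGraph) (y : V Y) where
    open ColouredGraph Y using (_≟_)

    paint : V Y → ℕ
    paint v with v ≟ y
    ... | yes _ = suc k
    ... | no _  = colour Y v

    painted : ColouredGraph
    painted = recolour Y paint

    paint-self : ∀ {v} → v ≡ y → paint v ≡ suc k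
    paint-self {v} v≡y with v ≟ y
    ... | yes _  = refl
    ... | no v≢y = contradiction v≡y v≢y

    paint-other : ∀ {v} → v ≢ y → paint v ≡ colour Y v
    paint-other {v} v≢y with v ≟ y
    ... | yes v≡y = contradiction v≡y v≢y
    ... | no _    = refl

    paint≢ : ∀ {v c} → c ≢ suc k → paint v ≡ c → v ≢ y
    paint≢ c≢ eq refl = c≢ (trans (sym eq) (paint-self refl))

    free-painted : Free g Y → Free g painted
    free-painted free e b = free e record
      { injective = injective
      ; colour-zero = λ i → trans (sym (paint-other (paint≢ (λ ()) (colour-zero i)))) (colour-zero i)
      ; inner⁺ = inner⁺ ; inner⁻ = inner⁻ ; outer⁺ = outer⁺ ; outer⁻ = outer⁻ }
      where open Block b

    -- Embeds the expansion of the painted graph in `expand Y`; only the copies of `y` other than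
    -- copy zero are missed.
    unpaint : Copy painted → Copy Y
    unpaint (v , i , a) = v , i , expanding-map i (λ eq →
      trans (sym (paint-other (paint≢ (λ k≡ → ℕ.1+n≢n (sym k≡)) eq))) eq) a

    unpaint-centre : (x : Copy painted) → proj₁ x ≡ y → proj₁ (proj₂ x) ≡ zero
    unpaint-centre (_ , i , a) refl = expanding-≢ i (λ eq → ℕ.1+n≢n (trans (sym (paint-self refl)) eq)) a

    unpaint-onto : ∀ x → (proj₁ x ≡ y → proj₁ (proj₂ x) ≡ zero) → ∃ λ x′ → unpaint x′ ≡ x
    unpaint-onto (v , i , a) centre = (v , i , a′) , copy-≡ {Y = Y} refl refl
      where
      a′ : Expanding k (paint v) i
      a′ with v ≟ y
      ... | yes v≡y = subst (Expanding k (suc k)) (sym (centre v≡y)) tt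
      ... | no _    = a

  module _ {Y Y′ : ColouredGraph} {y : V Y} {y′ : V Y′} (eq : colour Y y ≡ k) (eq′ : colour Y′ y′ ≡ k) where

    Matching : Iso (expand Y) (expand Y′) → Set
    Matching f = ∀ i → Iso.to f (copies {Y = Y} eq i) ≡ copies {Y = Y′} eq′ i

    private
      at-copies : ∀ {Y y} (eq : colour Y y ≡ k) x → proj₁ x ≡ y → x ≡ copies {Y = Y} eq (proj₁ (proj₂ x))
      at-copies {Y} eq x p = copy-≡ {Y = Y} p refl

    module _ (f : Iso (expand Y) (expand Y′)) (match : Matching f) where
      open Iso f

      at⁺ : ∀ x → proj₁ x ≡ y → to x ≡ copies {Y = Y′} eq′ (proj₁ (proj₂ x))
      at⁺ x p = trans (cong to (at-copies {Y} eq x p)) (match _)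

      at⁻ : ∀ x → proj₁ (to x) ≡ y′ → x ≡ copies {Y = Y} eq (proj₁ (proj₂ (to x)))
      at⁻ x p = to-injective (trans (at-copies {Y′} eq′ (to x) p) (sym (match _)))

      restrict : ∀ x → ∃ λ x′ → to (unpaint Y y x) ≡ unpaint Y′ y′ x′
      restrict x = let x′ , p = unpaint-onto Y′ y′ z centre in x′ , sym p
        where
        z = to (unpaint Y y x)
        centre : proj₁ z ≡ y′ → proj₁ (proj₂ z) ≡ zero
        centre p = trans (sym (cong (proj₁ ∘ proj₂) (at⁻ (unpaint Y y x) p)))
          (unpaint-centre Y y x (cong proj₁ (at⁻ (unpaint Y y x) p)))

  unpaint-injective : ∀ Y y {x x′} → unpaint Y y x ≡ unpaint Y y x′ → x ≡ x′
  unpaint-injective Y y eq = copy-≡ {Y = painted Y y} (cong proj₁ eq) (cong (proj₁ ∘ proj₂) eq)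

  painted-iso : ∀ {Y Y′ y y′} (eq : colour Y y ≡ k) (eq′ : colour Y′ y′ ≡ k) (f : Iso (expand Y) (expand Y′)) →
                Matching eq eq′ f → Iso (expand (painted Y y)) (expand (painted Y′ y′))
  painted-iso {Y} {Y′} {y} {y′} eq eq′ f match = relation⇒iso {X = expand (painted Y y)} {Y = expand (painted Y′ y′)}
    (λ x x′ → to (unpaint Y y x) ≡ unpaint Y′ y′ x′)
    (restrict eq eq′ f match)
    (λ x′ → let x , p = restrict eq′ eq (iso-sym f) match⁻ x′ in
            x , trans (cong to (sym p)) (to-from _))
    (λ {_} {x} {x′} p q → unpaint-injective Y′ y′ {x} {x′} (trans (sym p) q))
    (λ {x} {x′} p q → unpaint-injective Y y {x} {x′} (to-injective (trans p (sym q))))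
    (λ p q d → subst₂ (Edge (expand Y′)) p q (edge⁺ d))
    (λ p q d → edge⁻ (subst₂ (Edge (expand Y′)) (sym p) (sym q) d))
    (λ {x} {x′} → colours x x′)
    where
    open Iso f
    match⁻ : Matching eq′ eq (iso-sym f)
    match⁻ i = trans (cong from (sym (match i))) (from-to _)
    colours : ∀ x x′ → to (unpaint Y y x) ≡ unpaint Y′ y′ x′ →
              erase k (paint Y′ y′ (proj₁ x′)) ≡ erase k (paint Y y (proj₁ x))
    colours x x′ p = case ColouredGraph._≟_ Y (proj₁ x) y of λ
      { (yes q) → cong (erase k) (trans (paint-self Y′ y′ (at⇒ q)) (sym (paint-self Y y q)))
      ; (no ¬q) → trans (cong (erase k) (paint-other Y′ y′ (¬q ∘ at⇐)))
          (trans (cong (erase k ∘ colour Y′ ∘ proj₁) (sym p))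
          (trans (colour-to (unpaint Y y x)) (cong (erase k) (sym (paint-other Y y ¬q))))) }
      where
      at⇒ : proj₁ x ≡ y → proj₁ x′ ≡ y′
      at⇒ q = trans (sym (cong proj₁ p)) (cong proj₁ (at⁺ eq eq′ f match (unpaint Y y x) q))
      at⇐ : proj₁ x′ ≡ y′ → proj₁ x ≡ y
      at⇐ q = cong proj₁ (at⁻ eq eq′ f match (unpaint Y y x) (trans (cong proj₁ p) q))

  -- Returns the protected vertices to colour `k`, so that painting leaves no trace in the fused
  -- graph.
  fuse : ℕ → ℕ
  fuse c with c ℕ.≟ suc k
  ... | yes _ = k
  ... | no _  = c

  fused : ColouredGraph → ColouredGraph
  fused Y = recolour Y (fuse ∘ colour Y)

  fuse-≢ : ∀ {c} → c ≢ suc k → fuse c ≡ c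
  fuse-≢ {c} c≢ with c ℕ.≟ suc k
  ... | yes c≡ = contradiction c≡ c≢
  ... | no _   = refl

  fuse-suc : fuse (suc k) ≡ k
  fuse-suc with suc k ℕ.≟ suc k
  ... | yes _ = refl
  ... | no ≢  = contradiction refl ≢

  fused-painted : ∀ {y} → colour Y y ≡ k → Iso (fused Y) (fused (painted Y y))
  fused-painted {Y} {y} eq = recolour-iso (iso-refl {X = Y}) same
    where
    same : ∀ v → fuse (paint Y y v) ≡ fuse (colour Y v)
    same v with ColouredGraph._≟_ Y v y
    ... | yes refl = trans fuse-suc (sym (trans (cong fuse eq) (fuse-≢ (ℕ.1+n≢n ∘ sym))))
    ... | no _     = refl

  -- A copied vertex y of Y is matched with a copied vertex y′ of Y′, and both are protected
  -- from further expansion by the colour k + 1.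
  fused-iso : Conjugate g → ∀ {Y Y′} (ys : List (V Y)) → (∀ y → colour Y y ≡ k → y ∈ ys) →
              Free g Y → Free g Y′ → Iso (expand Y) (expand Y′) → Iso (fused Y) (fused Y′)
  fused-iso conj {Y} {Y′} [] marked free free′ f = recolour-iso Y≅Y′ λ v → cong fuse (Iso.colour-to Y≅Y′ v)
    where
    unmarked : ∀ y → colour Y y ≢ k
    unmarked y eq = case marked y eq of λ ()
    Y≅Y′ : Iso Y Y′
    -- Here `Y` is its own expansion, so `expand Y′` is block-free too; hence `Y′` has no vertex of
    -- colour `k` either and `f` is an isomorphism of the graphs themselves.
    Y≅Y′ = iso-trans (expand-unmarked unmarked) (iso-trans f (iso-sym (expand-unmarked
      (free-expand⇒unmarked {Y′} (free-iso g (iso-trans (expand-unmarked unmarked) f) free)))))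
  fused-iso conj {Y} {Y′} (y ∷ ys) marked free free′ f with colour Y y ℕ.≟ k
  ... | no y≢k = fused-iso conj ys
    (λ { v eq → case marked v eq of λ { (here refl) → contradiction eq y≢k ; (there v∈) → v∈ } }) free free′ f
  ... | yes eq with Fin.any? (λ i → colour Y′ (proj₁ (Iso.to f (copies {Y = Y} eq i))) ℕ.≟ k)
  -- If the image of the copies of `y` avoided all expanded vertices, it would come from a block of
  -- `Y′`, which is block-free.
  ...   | no ≢k = contradiction (lower-block g (λ i p → ≢k (i , p)) (block-iso g f (copies-block {Y = Y} eq))) (free′ _)
  -- Otherwise the image meets the copies of some `y′`, and an automorphism corrects `f` so that
  -- copies of `y` and `y′` match index by index.
  ...   | yes (i , eq′) =
    let σ , σ≡ = conj (block-iso g f (copies-block {Y = Y} eq)) (copies-block {Y = Y′} eq′) i _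
                   (copy-≡ {Y = Y′} refl refl)
    in iso-trans (fused-painted {Y} eq) (iso-trans
         (fused-iso conj ys covered (free-painted Y y free) (free-painted Y′ _ free′)
           (painted-iso eq eq′ (iso-trans f σ) σ≡))
         (iso-sym (fused-painted {Y′} eq′)))
    where
    covered : ∀ v → paint Y y v ≡ k → v ∈ ys
    covered v p = case marked v (trans (sym (paint-other Y y v≢y)) p) of λ
      { (here v≡y) → contradiction v≡y v≢y ; (there v∈) → v∈ }
      where
      v≢y : v ≢ y
      v≢y = paint≢ Y y (ℕ.1+n≢n ∘ sym) p

  -- The colour `suc k` is free at the start, so fusing changes neither graph and `fused-iso` is an
  -- isomorphism between the originals.
  expand-injective : Conjugate g → (ys : List (V Y)) → (∀ y → y ∈ ys) →
                     (∀ y → colour Y y ≢ suc k) → (∀ y → colour Y′ y ≢ suc k) →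
                     Free g Y → Free g Y′ → Iso (expand Y) (expand Y′) → Iso Y Y′
  expand-injective {Y} {Y′} conj ys all ≢k ≢k′ free free′ f = iso-trans
    (recolour-iso (iso-refl {X = Y}) (λ v → fuse-≢ (≢k v))) (iso-trans
    (fused-iso conj ys (λ y _ → all y) free free′ f)
    (recolour-iso (iso-refl {X = Y′}) (λ v → sym (fuse-≢ (≢k′ v)))))

-- Cycles, cliques and stars

Follows : ℕ → ℕ → ℕ → Set
Follows n a b = suc a ≡ b ⊎ (suc a ≡ n × b ≡ 0)

-- Vertices two steps apart are distinct and not joined. In a triangle the last conclusion would
-- fail. The cases differ in where the cycle wraps around.
follows-no-chord : ∀ {n a b c} → 4 ≤ n → Follows n a b → Follows n b c →
                   a ≢ b × a ≢ c × ¬ Follows n a c × ¬ Follows n c a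
follows-no-chord (s≤s (s≤s (s≤s (s≤s _)))) (inj₁ refl) (inj₁ refl) =
  (λ ()) , (λ ()) , (λ { (inj₁ ()) ; (inj₂ (_ , ())) }) , λ { (inj₁ ()) ; (inj₂ (() , refl)) }
follows-no-chord (s≤s (s≤s (s≤s (s≤s _)))) (inj₁ refl) (inj₂ (refl , refl)) =
  (λ ()) , (λ ()) , (λ { (inj₁ ()) ; (inj₂ (() , _)) }) , λ { (inj₁ ()) ; (inj₂ (() , _)) }
follows-no-chord (s≤s (s≤s (s≤s (s≤s _)))) (inj₂ (refl , refl)) (inj₁ refl) =
  (λ ()) , (λ ()) , (λ { (inj₁ ()) ; (inj₂ (_ , ())) }) , λ { (inj₁ ()) ; (inj₂ (() , _)) }
follows-no-chord (s≤s (s≤s (s≤s (s≤s _)))) (inj₂ (refl , refl)) (inj₂ (() , _))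

follows-exists : 1 ≤ n → (i : Fin n) → ∃ λ (j : Fin n) → Follows n (Fin.toℕ i) (Fin.toℕ j)
follows-exists {suc n} _ i with suc (Fin.toℕ i) ℕ.<? suc n
... | yes i+1<n = Fin.fromℕ< i+1<n , inj₁ (sym (Fin.toℕ-fromℕ< i+1<n))
... | no i+1≮n  = zero , inj₂ (ℕ.≤-antisym (Fin.toℕ<n i) (ℕ.≮⇒≥ i+1≮n) , refl)

precedes-exists : (i : Fin n) → ∃ λ (j : Fin n) → Follows n (Fin.toℕ j) (Fin.toℕ i)
precedes-exists {suc n} zero    = Fin.fromℕ n , inj₂ (cong suc (Fin.toℕ-fromℕ n) , refl)
precedes-exists {suc n} (suc i) = Fin.inject₁ i , inj₁ (cong suc (Fin.toℕ-inject₁ i))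

follows : ∀ n → Fin n → Fin n → Bool
follows n i j = (suc (Fin.toℕ i) ≡ᵇ Fin.toℕ j) ∨ ((suc (Fin.toℕ i) ≡ᵇ n) ∧ (Fin.toℕ j ≡ᵇ 0))

follows⇒T : {i j : Fin n} → Follows n (Fin.toℕ i) (Fin.toℕ j) → T (follows n i j)
follows⇒T (inj₁ p)       = Equivalence.from T-∨ (inj₁ (ℕ.≡⇒≡ᵇ _ _ p))
follows⇒T {n} {i} {j} (inj₂ (p , q)) = Equivalence.from (T-∨ {suc (Fin.toℕ i) ≡ᵇ Fin.toℕ j})
  (inj₂ (Equivalence.from T-∧ (ℕ.≡⇒≡ᵇ _ _ p , ℕ.≡⇒≡ᵇ _ _ q)))

T⇒follows : {i j : Fin n} → T (follows n i j) → Follows n (Fin.toℕ i) (Fin.toℕ j)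
T⇒follows {n} {i} {j} t with Equivalence.to (T-∨ {suc (Fin.toℕ i) ≡ᵇ Fin.toℕ j}) t
... | inj₁ p = inj₁ (ℕ.≡ᵇ⇒≡ _ _ p)
... | inj₂ pq = let p , q = Equivalence.to (T-∧ {suc (Fin.toℕ i) ≡ᵇ n}) pq in
  inj₂ (ℕ.≡ᵇ⇒≡ _ _ p , ℕ.≡ᵇ⇒≡ _ _ q)

C-edge⁺ : {i j : Fin n} → i ≢ j → Follows n (Fin.toℕ i) (Fin.toℕ j) → Adj (C n) i j
C-edge⁺ {n} {i} {j} i≢j f with i Fin.≟ j
... | yes i≡j = i≢j i≡j
... | no _    = Equivalence.from T-∨ (inj₁ (follows⇒T f))

C-edge-sym : ∀ n {i j} → Adj (C n) i j → Adj (C n) j i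
C-edge-sym n {i} {j} = subst T (adj-sym (C n) i j)

C-edge⁻ : {i j : Fin n} → Adj (C n) i j →
          Follows n (Fin.toℕ i) (Fin.toℕ j) ⊎ Follows n (Fin.toℕ j) (Fin.toℕ i)
C-edge⁻ {n} {i} {j} d with Equivalence.to (T-∨ {follows n i j} {follows n j i})
                             (proj₂ (Equivalence.to (T-∧ {not (does (i Fin.≟ j))}) d))
... | inj₁ t = inj₁ (T⇒follows {i = i} {j} t)
... | inj₂ t = inj₂ (T⇒follows {i = j} {i} t)

-- The witness is the neighbour of `i` on the side away from `j`, two steps from `j`.
C-private-neighbour : 4 ≤ n → {i j : Fin n} → Adj (C n) i j →
                      ∃ λ w → Adj (C n) i w × w ≢ j × ¬ Adj (C n) j w
C-private-neighbour {n} 4≤n {i} {j} d with C-edge⁻ d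
... | inj₁ ij =
  let w , wi = precedes-exists i
      w≢i , w≢j , ¬wj , ¬jw = follows-no-chord 4≤n wi ij
  in w , C-edge-sym n {w} {i} (C-edge⁺ (w≢i ∘ cong Fin.toℕ) wi) , w≢j ∘ cong Fin.toℕ , λ jw →
     case C-edge⁻ jw of λ { (inj₁ p) → ¬jw p ; (inj₂ p) → ¬wj p }
... | inj₂ ji =
  let w , iw = follows-exists (ℕ.≤-trans (s≤s z≤n) 4≤n) i
      j≢i , j≢w , ¬jw , ¬wj = follows-no-chord 4≤n ji iw
      -- One further step along the cycle is taken only to obtain `i≢w`, which `C-edge⁺` requires.
      i≢w , _ = follows-no-chord 4≤n iw (proj₂ (follows-exists (ℕ.≤-trans (s≤s z≤n) 4≤n) w))
  in w , C-edge⁺ (i≢w ∘ cong Fin.toℕ) iw , j≢w ∘ sym ∘ cong Fin.toℕ , λ jw →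
     case C-edge⁻ jw of λ { (inj₁ p) → ¬jw p ; (inj₂ p) → ¬wj p }

C-two-neighbours : 4 ≤ n → (i : Fin n) → ∃₂ λ j w → Adj (C n) i j × Adj (C n) i w × w ≢ j
C-two-neighbours {n} 4≤n i =
  let j , ij = follows-exists (ℕ.≤-trans (s≤s z≤n) 4≤n) i
      i≢j , _ = follows-no-chord 4≤n ij (proj₂ (follows-exists (ℕ.≤-trans (s≤s z≤n) 4≤n) j))
      d = C-edge⁺ (i≢j ∘ cong Fin.toℕ) ij
      w , iw , w≢j , _ = C-private-neighbour 4≤n d
  in j , w , d , iw , w≢j

record Cycle (ℓ : ℕ) (X : ColouredGraph) : Set where
  field
    at        : Fin ℓ → V X
    injective : ∀ {i j} → at i ≡ at j → i ≡ j
    edge⁺     : ∀ {i j} → Adj (C ℓ) i j → Edge X (at i) (at j)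
    edge⁻     : ∀ {i j} → Edge X (at i) (at j) → Adj (C ℓ) i j

cycle-iso : Iso X Y → Cycle ℓ X → Cycle ℓ Y
cycle-iso f c = record
  { at = to ∘ at ; injective = injective ∘ to-injective
  ; edge⁺ = edge⁺ ∘ c.edge⁺ ; edge⁻ = c.edge⁻ ∘ edge⁻ }
  where
  open Iso f
  module c = Cycle c
  open c using (at; injective)

module _ (X : ColouredGraph) where
  open ColouredGraph X using (_≟_)

  Leaf-of : V X → V X → Set
  Leaf-of x v = Edge X x v × (∀ w → Edge X w v → w ≡ x)

  Dominates : V X → V X → Set
  Dominates u v = ∀ w → w ≢ v → Edge X w u → Edge X w v

  cycle-leafless : 4 ≤ ℓ → (c : Cycle ℓ X) → ∀ {a x} → ¬ Leaf-of x (Cycle.at c a)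
  cycle-leafless {ℓ} 4≤ℓ c {a} (_ , only) =
    let j , w , aj , aw , w≢j = C-two-neighbours 4≤ℓ a
    in w≢j (injective (trans (only _ (edge-sym X (edge⁺ aw))) (sym (only _ (edge-sym X (edge⁺ aj))))))
    where open Cycle c

  cycle-undominated : 4 ≤ ℓ → (c : Cycle ℓ X) → ∀ {a b} → Edge X (Cycle.at c a) (Cycle.at c b) →
                      ¬ Dominates (Cycle.at c a) (Cycle.at c b)
  cycle-undominated {ℓ} 4≤ℓ c {a} {b} d dom =
    let w , aw , w≢b , ¬bw = C-private-neighbour 4≤ℓ (edge⁻ d)
    in ¬bw (edge⁻ (edge-sym X (dom (at w) (w≢b ∘ injective) (edge-sym X (edge⁺ aw)))))
    where open Cycle c

  swap : V X → V X → V X → V X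
  swap u v x with x ≟ u | x ≟ v
  ... | yes _ | _     = v
  ... | no _  | yes _ = u
  ... | no _  | no _  = x

  -- The graph of the transposition. The condition `x ≢ u` in `at-right` keeps the cases disjoint
  -- even when `u` and `v` coincide.
  data Swap (u v : V X) (x : V X) : V X → Set where
    at-left  : x ≡ u → Swap u v x v
    at-right : x ≢ u → x ≡ v → Swap u v x u
    fixed    : x ≢ u → x ≢ v → Swap u v x x

  swap-view : ∀ u v x → Swap u v x (swap u v x)
  swap-view u v x with x ≟ u | x ≟ v
  ... | yes p | _     = at-left p
  ... | no ¬p | yes q = at-right ¬p q
  ... | no ¬p | no ¬q = fixed ¬p ¬q

  swap-unique : ∀ {u v x y} → Swap u v x y → swap u v x ≡ y
  swap-unique {u} {v} {x} s with swap u v x | swap-view u v x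
  swap-unique (at-left _)     | _ | at-left _     = refl
  swap-unique (at-right ¬p _) | _ | at-left p     = contradiction p ¬p
  swap-unique (fixed ¬p _)    | _ | at-left p     = contradiction p ¬p
  swap-unique (at-left p)     | _ | at-right ¬p _ = contradiction p ¬p
  swap-unique (at-right _ _)  | _ | at-right _ _  = refl
  swap-unique (fixed _ ¬q)    | _ | at-right _ q  = contradiction q ¬q
  swap-unique (at-left p)     | _ | fixed ¬p _    = contradiction p ¬p
  swap-unique (at-right _ q)  | _ | fixed _ ¬q    = contradiction q ¬q
  swap-unique (fixed _ _)     | _ | fixed _ _     = refl

  swap-reverse : ∀ {u v x y} → Swap u v x y → Swap u v y x
  swap-reverse {u} {v} (at-left refl) with v ≟ u
  ... | yes refl = at-left refl
  ... | no v≢u   = at-right v≢u refl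
  swap-reverse (at-right _ refl) = at-left refl
  swap-reverse (fixed p q)       = fixed p q

  -- Nothing is said about an edge between `u` and `v`: siblings are joined, two leaves at one
  -- centre need not be, and the transposition is an automorphism in either case.
  Twins : V X → V X → Set
  Twins u v = colour X u ≡ colour X v ×
              (∀ w → w ≢ u → w ≢ v → Edge X w u → Edge X w v) ×
              (∀ w → w ≢ u → w ≢ v → Edge X w v → Edge X w u)

  module _ {u v : V X} (twins : Twins u v) where
    private
      uv = proj₁ (proj₂ twins)
      vu = proj₂ (proj₂ twins)

    swap-edge : ∀ {x x′ y y′} → Swap u v x x′ → Swap u v y y′ → Edge X x y → Edge X x′ y′
    swap-edge (at-left refl)    (at-left refl)    d = contradiction d (edge-irrefl X)
    swap-edge (at-left refl)    (at-right _ refl) d = edge-sym X d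
    swap-edge (at-left refl)    (fixed p q)       d = edge-sym X (uv _ p q (edge-sym X d))
    swap-edge (at-right _ refl) (at-left refl)    d = edge-sym X d
    swap-edge (at-right _ refl) (at-right _ refl) d = contradiction d (edge-irrefl X)
    swap-edge (at-right _ refl) (fixed p q)       d = edge-sym X (vu _ p q (edge-sym X d))
    swap-edge (fixed p q)       (at-left refl)    d = uv _ p q d
    swap-edge (fixed p q)       (at-right _ refl) d = vu _ p q d
    swap-edge (fixed _ _)       (fixed _ _)       d = d

    swap-colour : ∀ {x y} → Swap u v x y → colour X y ≡ colour X x
    swap-colour (at-left refl)    = sym (proj₁ twins)
    swap-colour (at-right _ refl) = proj₁ twins
    swap-colour (fixed _ _)       = refl

    swap-iso : Iso X X
    swap-iso = record
      { to = swap u v ; from = swap u v ; from-to = involutive ; to-from = involutive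
      ; edge⁺ = λ {x} {y} → swap-edge (view x) (view y)
      ; edge⁻ = λ {x} {y} → swap-edge (swap-reverse (view x)) (swap-reverse (view y))
      ; colour-to = swap-colour ∘ view }
      where
      view = swap-view u v
      involutive : ∀ x → swap u v (swap u v x) ≡ x
      involutive x = swap-unique (swap-reverse (view x))

  -- The automorphism is a product of transpositions of twins.
  align : (S : V X → Set) → (∀ {u v} → S u → S v → Twins u v) →
          ∀ {n} (e e′ : Fin n → V X) → (∀ {i j} → e i ≡ e j → i ≡ j) → (∀ {i j} → e′ i ≡ e′ j → i ≡ j) →
          (∀ i → S (e i)) → (∀ i → S (e′ i)) →
          ∃ λ (σ : Iso X X) → (∀ i → Iso.to σ (e i) ≡ e′ i) × (∀ {v} → S v → S (Iso.to σ v))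
  align S twins {zero}  e e′ inj inj′ s s′ = iso-refl , (λ ()) , id
  align S twins {suc n} e e′ inj inj′ s s′ with
    align S twins (e ∘ suc) (e′ ∘ suc) (Fin.suc-injective ∘ inj) (Fin.suc-injective ∘ inj′) (s ∘ suc) (s′ ∘ suc)
  ... | σ , σ≡ , σS = iso-trans σ (swap-iso (twins su (s′ zero))) , maps , λ sv → swap-S (swap-view u _ _) (σS sv)
    where
    u = Iso.to σ (e zero)
    su = σS (s zero)
    maps : ∀ i → swap u (e′ zero) (Iso.to σ (e i)) ≡ e′ i
    maps zero    = swap-unique (at-left refl)
    -- By injectivity of `e` and of `e′`, the last transposition does not touch the vertices already
    -- placed.
    maps (suc i) = trans (swap-unique (fixed (λ p → case inj (Iso.to-injective σ p) of λ ())
      (λ p → case inj′ (trans (sym (σ≡ i)) p) of λ ()))) (σ≡ i)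
    swap-S : ∀ {x y} → Swap u (e′ zero) x y → S x → S y
    swap-S (at-left _)    _  = s′ zero
    swap-S (at-right _ _) _  = su
    swap-S (fixed _ _)    sx = sx

-- A block of this gadget consists of 2 + r mutual siblings.
clique : ∀ r → Gadget r
clique r = record
  { Inner = _≢_ ; inner-sym = λ p → p ∘ sym ; inner-irrefl = λ p → p refl
  ; inner-centre = λ _ () ; Port = λ _ → ⊤ ; port-centre = tt }

Centre : Fin (suc n) → Set
Centre zero    = ⊤
Centre (suc _) = ⊥

Spoke : Fin (suc n) → Fin (suc n) → Set
Spoke zero    (suc _) = ⊤
Spoke (suc _) zero    = ⊤
Spoke _       _       = ⊥

-- A block of this gadget consists of a vertex, at index zero, and 1 + r of its leaves.
star : ∀ r → Gadget r
star r = record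
  { Inner = Spoke ; inner-sym = λ {i} {j} → spoke-sym i j ; inner-irrefl = λ {i} → spoke-irrefl i
  ; inner-centre = λ _ → tt ; Port = Centre ; port-centre = tt }
  where
  spoke-sym : ∀ {n} (i j : Fin (suc n)) → Spoke i j → Spoke j i
  spoke-sym zero    (suc _) _ = tt
  spoke-sym (suc _) zero    _ = tt
  spoke-irrefl : ∀ {n} (i : Fin (suc n)) → ¬ Spoke i i
  spoke-irrefl zero    ()
  spoke-irrefl (suc _) ()

module _ {e : Fin (2 + r) → V X} (b : Block (clique r) X e) where
  open Block b
  open ColouredGraph X using (_≟_)

  clique-dominates : ∀ i j → Dominates X (e i) (e j)
  clique-dominates i j w w≢ d with Fin.any? (λ l → w ≟ e l)
  ... | yes (l , refl) = inner⁺ (w≢ ∘ cong e)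
  ... | no out = outer⁺ w∉ tt (proj₂ (outer⁻ w∉ d))
    where
    w∉ : ∀ l → w ≢ e l
    w∉ l p = out (l , p)

module _ {e : Fin (2 + r) → V X} (b : Block (star r) X e) where
  open Block b
  open ColouredGraph X using (_≟_)

  star-leaf : ∀ i → Leaf-of X (e zero) (e (suc i))
  star-leaf i = inner⁺ tt , only
    where
    only : ∀ w → Edge X w (e (suc i)) → w ≡ e zero
    only w d with Fin.any? (λ l → w ≟ e l)
    ... | no out = ⊥-elim (proj₁ (outer⁻ (λ l p → out (l , p)) d))
    ... | yes (zero , p)     = p
    ... | yes (suc _ , refl) = ⊥-elim (inner⁻ d)

-- Both blocks lie in the set `S` of vertices of colour 0 with the same closed neighbourhood as the
-- common vertex `e i`, and any two members of `S` are twins.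
clique-conjugate : Conjugate (clique r)
clique-conjugate {X = X} {e} {e′} b b′ i j meet =
  let σ , σ≡ , _ = align X S twins e e′ B.injective B′.injective inS
                     (λ l → B′.colour-zero l , subst (λ x → Near x (e′ l)) (sym meet) (near b′ j l))
  in σ , σ≡
  where
  module B = Block b
  module B′ = Block b′
  open ColouredGraph X using (_≟_)
  Near : V X → V X → Set
  Near x v = (v ≡ x ⊎ Edge X x v) × Dominates X x v × Dominates X v x
  S : V X → Set
  S v = colour X v ≡ 0 × Near (e i) v
  near : ∀ {e} → Block (clique _) X e → ∀ i l → Near (e i) (e l)
  near {e} b i l with i Fin.≟ l
  ... | yes refl = inj₁ refl , clique-dominates b i i , clique-dominates b i i
  ... | no i≢l   = inj₂ (Block.inner⁺ b i≢l) , clique-dominates b i l , clique-dominates b l i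
  inS : ∀ l → S (e l)
  inS l = B.colour-zero l , near b i l
  dominates : ∀ {u v} → S u → S v → ∀ w → w ≢ u → w ≢ v → Edge X w u → Edge X w v
  dominates {u} {v} (_ , _ , _ , u≤) (_ , x-v , ≤v , _) w w≢u w≢v d with w ≟ e i | x-v
  ... | no w≢    | _        = ≤v w w≢v (u≤ w w≢ d)
  -- Domination does not compose through `e i` when `w` is `e i` itself; there the edge between
  -- `e i` and `v` is used.
  ... | yes refl | inj₁ v≡x = contradiction (sym v≡x) w≢v
  ... | yes refl | inj₂ xv  = xv
  twins : ∀ {u v} → S u → S v → Twins X u v
  twins su@(cu , _) sv@(cv , _) = trans cu (sym cv) , dominates su sv , λ w w≢u w≢v → dominates sv su w w≢v w≢u

private
  -- Leaves at the same centre are twins, so the leaves can be aligned. The centre follows, being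
  -- the only neighbour of a leaf.
  star-conjugate-centred : ∀ {e e′} → Block (star r) X e → Block (star r) X e′ → e zero ≡ e′ zero →
                           ∃ λ (σ : Iso X X) → ∀ i → Iso.to σ (e i) ≡ e′ i
  star-conjugate-centred {X = X} {e} {e′} b b′ same =
    let σ , σ≡ , _ = align X S twins (e ∘ suc) (e′ ∘ suc)
                       (Fin.suc-injective ∘ B.injective) (Fin.suc-injective ∘ B′.injective)
                       (λ i → B.colour-zero (suc i) , star-leaf b i)
                       (λ i → B′.colour-zero (suc i) , subst (λ c → Leaf-of X c (e′ (suc i))) (sym same) (star-leaf b′ i))
    in σ , λ { zero → proj₂ (star-leaf b′ zero) _ (subst (Edge X _) (σ≡ zero) (Iso.edge⁺ σ (proj₁ (star-leaf b zero))))
             ; (suc i) → σ≡ i }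
    where
    module B = Block b
    module B′ = Block b′
    S : V X → Set
    S v = colour X v ≡ 0 × Leaf-of X (e zero) v
    twins : ∀ {u v} → S u → S v → Twins X u v
    twins (cu , cu-edge , u-only) (cv , cv-edge , v-only) = trans cu (sym cv) ,
      (λ w _ _ d → subst (λ c → Edge X c _) (sym (u-only w d)) cv-edge) ,
      (λ w _ _ d → subst (λ c → Edge X c _) (sym (v-only w d)) cu-edge)

  -- Two distinct centres in one block are adjacent leaves of each other: the blocks are the two
  -- orderings of a component with two vertices.
  star-conjugate-crossed : ∀ {e e′} → Block (star r) X e → Block (star r) X e′ → ∀ j → e zero ≡ e′ (suc j) →
                           ∃ λ (σ : Iso X X) → ∀ i → Iso.to σ (e i) ≡ e′ i
  star-conjugate-crossed {X = X} {e} {e′} b b′ j cross = swap-iso X twins , maps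
    where
    module B = Block b
    module B′ = Block b′
    leaf : ∀ i → e (suc i) ≡ e′ zero
    leaf i = proj₂ (star-leaf b′ j) _ (subst (Edge X _) cross (edge-sym X (proj₁ (star-leaf b i))))
    leaf′ : ∀ i → e′ (suc i) ≡ e zero
    leaf′ i = proj₂ (star-leaf b zero) _
      (subst (Edge X _) (sym (leaf zero)) (edge-sym X (proj₁ (star-leaf b′ i))))
    twins : Twins X (e zero) (e′ zero)
    twins = trans (B.colour-zero zero) (sym (B′.colour-zero zero)) ,
      (λ w _ w≢ d → contradiction (proj₂ (star-leaf b′ j) w (subst (Edge X w) cross d)) w≢) ,
      (λ w w≢ _ d → contradiction (proj₂ (star-leaf b zero) w (subst (Edge X w) (sym (leaf zero)) d)) w≢)
    maps : ∀ i → swap X (e zero) (e′ zero) (e i) ≡ e′ i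
    maps zero    = swap-unique X (at-left refl)
    maps (suc i) = trans (swap-unique X (at-right (λ p → case B.injective p of λ ()) (leaf i))) (sym (leaf′ i))

star-conjugate : Conjugate (star r)
star-conjugate b b′ zero    zero    meet = star-conjugate-centred b b′ meet
star-conjugate b b′ zero    (suc j) meet = star-conjugate-crossed b b′ j meet
star-conjugate {X = X} b b′ (suc i) zero meet =
  let σ , σ≡ = star-conjugate-crossed b′ b i (sym meet)
  in iso-sym σ , λ l → trans (cong (Iso.from σ) (sym (σ≡ l))) (Iso.from-to σ _)
star-conjugate {X = X} b b′ (suc i) (suc j) meet = star-conjugate-centred b b′
  (proj₂ (star-leaf b′ j) _ (subst (Edge X _) meet (proj₁ (star-leaf b i))))

Apart : Gadget r → Gadget s → Set₁
Apart g h = ∀ {X e e′} → Block g X e → Block h X e′ → ∀ i j → e i ≢ e′ j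

private
  all-equal⇒zero : ∀ {A : Set} {x : A} (e : Fin (suc n) → A) → (∀ {i j} → e i ≡ e j → i ≡ j) →
                   (∀ i → e i ≡ x) → n ≡ 0
  all-equal⇒zero {zero}  e inj eq = refl
  all-equal⇒zero {suc n} e inj eq = case inj (trans (eq zero) (sym (eq (suc zero)))) of λ ()

other : (i : Fin (2 + r)) → ∃ λ j → j ≢ i
other zero    = suc zero , λ ()
other (suc i) = zero , λ ()

-- If a clique vertex is a leaf of the star, all other clique vertices equal the centre, so `r` is
-- 0. Centre and leaf are then siblings, so a second leaf would be joined to the first; hence `s` is
-- 0 as well.
clique-leaf-apart : r ≢ s → ∀ {e e′} → Block (clique r) X e → Block (star s) X e′ → ∀ i j → e i ≢ e′ (suc j)
clique-leaf-apart {r} {s} {X} r≢s {e} {e′} b b′ i j meet =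
  r≢s (trans (all-equal⇒zero (λ l → e (Fin.punchIn i l)) (λ p → Fin.punchIn-injective i _ _ (Block.injective b p))
               (λ l → at-centre _ (Fin.punchInᵢ≢i i l)))
        (sym (all-equal⇒zero (e′ ∘ suc) (Fin.suc-injective ∘ Block.injective b′) at-leaf)))
  where
  at-centre : ∀ l → l ≢ i → e l ≡ e′ zero
  at-centre l l≢i = proj₂ (star-leaf b′ j) _ (subst (Edge X _) meet (Block.inner⁺ b l≢i))
  at-leaf : ∀ l → e′ (suc l) ≡ e i
  at-leaf l with ColouredGraph._≟_ X (e′ (suc l)) (e i)
  ... | yes p = p
  ... | no ≢x = contradiction
    (proj₂ (star-leaf b′ j) _ (subst (Edge X _) meet (clique-dominates b (proj₁ (other i)) i _ ≢x
      (subst (Edge X _) (sym (at-centre _ (proj₂ (other i)))) (edge-sym X (proj₁ (star-leaf b′ l)))))))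
    (λ p → case Block.injective b′ p of λ ())
-- If the centre lies in the clique, domination makes its leaf a clique vertex, or a neighbour of a
-- second clique vertex, which then equals the centre.
clique-star-apart : r ≢ s → Apart (clique r) (star s)
clique-star-apart r≢s b b′ i (suc j) meet = clique-leaf-apart r≢s b b′ i j meet
clique-star-apart r≢s {X} {e} {e′} b b′ i zero meet with ColouredGraph._≟_ X (e′ (suc zero)) (e (proj₁ (other i)))
... | yes p = clique-leaf-apart r≢s b b′ (proj₁ (other i)) zero (sym p)
... | no ≢l = proj₂ (other i) (Block.injective b (trans
  (proj₂ (star-leaf b′ zero) _ (edge-sym X (clique-dominates b i _ _ ≢l
    (subst (Edge X _) (sym meet) (edge-sym X (proj₁ (star-leaf b′ zero)))))))
  (sym meet)))

-- An induced cycle meets a block in at most one vertex, and that vertex is a port; so it remains an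
-- induced cycle when the block is contracted.
CycleAvoiding : Gadget r → Set₁
CycleAvoiding g = ∀ {X e ℓ} → 4 ≤ ℓ → Block g X e → (c : Cycle ℓ X) →
  (∀ a i → Cycle.at c a ≡ e i → Gadget.Port g i) ×
  (∀ a b i j → Cycle.at c a ≡ e i → Cycle.at c b ≡ e j → i ≡ j)

clique-avoiding : CycleAvoiding (clique r)
clique-avoiding {X = X} {e} 4≤ℓ b c = (λ _ _ _ → tt) , λ a a′ i j p q → case i Fin.≟ j of λ
  { (yes i≡j) → i≡j
  ; (no i≢j) → contradiction (subst₂ (Dominates X) (sym p) (sym q) (clique-dominates b i j))
      (cycle-undominated X 4≤ℓ c (subst₂ (Edge X) (sym p) (sym q) (Block.inner⁺ b i≢j))) }

star-avoiding : CycleAvoiding (star r)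
star-avoiding {X = X} {e} 4≤ℓ b c = port , λ
  { a a′ zero zero p q → refl
  ; a a′ (suc i) j p q → ⊥-elim (port a (suc i) p)
  ; a a′ zero (suc j) p q → ⊥-elim (port a′ (suc j) q) }
  where
  port : ∀ a i → Cycle.at c a ≡ e i → Centre i
  port a zero    p = tt
  port a (suc i) p = cycle-leafless X 4≤ℓ c (subst (Leaf-of X (e zero)) (sym p) (star-leaf b i))

-- Weighted classes

≡⇒↔ : {A B : Set} → A ≡ B → A ↔ B
≡⇒↔ refl = ↔-id _

-- Colours are at most c, and each of the colours 1, …, k is used. The elements of Wt i make up
-- the weight of a vertex of colour i, and M is the total weight.
record Base (c k : ℕ) (Wt : ℕ → Set) (M : ℕ) (X : ColouredGraph) : Set where
  field
    small      : ∀ v → colour X v ≤ c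
    occurs     : ∀ (i : Fin k) → ∃ λ v → colour X v ≡ suc (Fin.toℕ i)
    weight     : Σ (V X) (Wt ∘ colour X) ↔ Fin M
    connected  : ∀ u v → Star (Edge X) u v
    cycle-free : ∀ ℓ → 4 ≤ ℓ → ¬ Cycle ℓ X

base-iso : ∀ {c k Wt M} → Iso X Y → Base c k Wt M X → Base c k Wt M Y
base-iso {X} {Y} {c} {k} {Wt} f b = record
  { small = λ v → subst (_≤ c) (colour-from v) (small (from v))
  ; occurs = λ i → let v , p = occurs i in to v , trans (colour-to v) p
  ; weight = weight ↔-∘ ↔-sym (Σ-↔ (mk↔ₛ′ to from to-from from-to) (≡⇒↔ (cong Wt (sym (colour-to _)))))
  ; connected = λ u v → subst₂ (Star (Edge Y)) (to-from u) (to-from v) (gmap to edge⁺ (connected (from u) (from v)))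
  ; cycle-free = λ ℓ 4≤ℓ c → cycle-free ℓ 4≤ℓ (cycle-iso (iso-sym f) c)
  }
  where
  open Iso f
  open Base b

module _ {c k : ℕ} {Wt : ℕ → Set} {M : ℕ} (pt : ∀ i → Wt i) (b : Base c k Wt M X) where
  open Base b

  -- Every vertex owns at least one unit of weight; numbering it by such a unit shows that there are
  -- at most `M` vertices.
  number : V X → Fin M
  number v = Inverse.to weight (v , pt (colour X v))

  number-injective : ∀ {u v} → number u ≡ number v → u ≡ v
  number-injective {u} {v} p = cong proj₁ (trans (sym (strictlyInverseʳ _)) (trans (cong from p) (strictlyInverseʳ _)))
    where open Inverse weight

  listed : ¬ ¬ ∃ λ (vs : List (V X)) → ∀ v → v ∈ vs
  listed = do
    dec ← ¬¬-∀Fin (λ i → ¬¬-excluded-middle {A = ∃ λ v → number v ≡ i})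
    return (List.concat (List.tabulate (entry ∘ dec)) , λ v →
      Any.concat⁺ (Any.tabulate⁺ {f = entry ∘ dec} (number v) (found (dec (number v)))))
    where
    entry : ∀ {i} → Dec (∃ λ v → number v ≡ i) → List (V X)
    entry (yes (v , _)) = v ∷ []
    entry (no _)        = []
    found : ∀ {v} (d : Dec (∃ λ u → number u ≡ number v)) → v ∈ entry d
    found (yes (_ , p)) = here (sym (number-injective p))
    found {v} (no ¬p)   = contradiction (v , refl) ¬p

  colours≤weight : k ≤ M
  colours≤weight = Fin.injective⇒≤ {f = λ i → number (proj₁ (occurs i))} λ {i} {j} p →
    Fin.toℕ-injective (ℕ.suc-injective (trans (sym (proj₂ (occurs i)))
      (trans (cong (colour X) (number-injective p)) (proj₂ (occurs j)))))

-- Every graph of a class Base c k Wt M embeds its vertices into Fin M, hence is isomorphic to one of these.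
decoded : ∀ {M c} → (Fin M → Fin 2) → (Fin M → Fin M → Fin 2) → (Fin M → Fin (suc c)) → ColouredGraph
decoded present joined colours = record
  { V = ∃ λ i → present i ≡ zero
  ; _≟_ = λ (i , p) (j , q) → map′ (λ { refl → cong (i ,_) (≡-irrelevant p q) }) (cong proj₁) (i Fin.≟ j)
  ; Edge = λ (i , _) (j , _) → i ≢ j × (joined i j ≡ zero ⊎ joined j i ≡ zero)
  ; edge-sym = λ { (p , inj₁ q) → p ∘ sym , inj₂ q ; (p , inj₂ q) → p ∘ sym , inj₁ q }
  ; edge-irrefl = λ (p , _) → p refl
  ; colour = λ (i , _) → Fin.toℕ (colours i)
  }

codes : ℕ → ℕ → List ColouredGraph
codes M c = List.cartesianProductWith
  (λ p (e , q) → decoded (Fin.finToFun {2} {M} p) (λ i → Fin.finToFun {2} {M} (Fin.finToFun {2 ^ M} {M} e i))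
                         (Fin.finToFun {suc c} {M} q))
  (List.allFin (2 ^ M)) (List.cartesianProduct (List.allFin ((2 ^ M) ^ M)) (List.allFin (suc c ^ M)))

base-coded : ∀ {c k Wt M} → (∀ i → Wt i) → Base c k Wt M X → ¬ ¬ Any (Iso X) (codes M c)
base-coded {X} {c} {k} {Wt} {M} pt b = do
  present? ← ¬¬-∀Fin (λ i → ¬¬-excluded-middle {A = ∃ λ v → ι v ≡ i})
  joined?  ← ¬¬-∀Fin (λ i → ¬¬-∀Fin (λ j →
               ¬¬-excluded-middle {A = ∃₂ λ u v → ι u ≡ i × ι v ≡ j × Edge X u v}))
  return (code present? joined?)
  where
  open Base b
  ι = number pt b
  module _ (present? : ∀ i → Dec (∃ λ v → ι v ≡ i))
           (joined? : ∀ i j → Dec (∃₂ λ u v → ι u ≡ i × ι v ≡ j × Edge X u v)) where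
    bit : ∀ {A : Set} → Dec A → Fin 2
    bit (yes _) = zero
    bit (no _)  = suc zero
    bit⁻ : ∀ {A : Set} (d : Dec A) → bit d ≡ zero → A
    bit⁻ (yes a) _ = a
    bit⁺ : ∀ {A : Set} (d : Dec A) → A → bit d ≡ zero
    bit⁺ (yes _) _ = refl
    bit⁺ (no ¬a) a = contradiction a ¬a
    hue : ∀ {i} → Dec (∃ λ v → ι v ≡ i) → Fin (suc c)
    hue (yes (v , _)) = Fin.fromℕ< (s≤s (small v))
    -- A default for numbers that belong to no vertex; `decoded` never consults it.
    hue (no _)        = zero
    hue-correct : ∀ v (d : Dec (∃ λ u → ι u ≡ ι v)) → Fin.toℕ (hue d) ≡ colour X v
    hue-correct v (yes (u , p)) = trans (Fin.toℕ-fromℕ< (s≤s (small u))) (cong (colour X) (number-injective pt b p))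
    hue-correct v (no ¬p) = contradiction (v , refl) ¬p
    P = Fin.finToFun {2} {M} (Fin.funToFin (bit ∘ present?))
    E : Fin M → Fin M → Fin 2
    E i = Fin.finToFun {2} {M} (Fin.finToFun {2 ^ M} {M} (Fin.funToFin (λ i → Fin.funToFin (λ j → bit (joined? i j)))) i)
    H = Fin.finToFun {suc c} {M} (Fin.funToFin (hue ∘ present?))
    P≡ : ∀ i → P i ≡ bit (present? i)
    P≡ = Fin.finToFun-funToFin _
    E≡ : ∀ i j → E i j ≡ bit (joined? i j)
    E≡ i j = trans (cong (λ c → Fin.finToFun {2} {M} c j) (Fin.finToFun-funToFin {M} {2 ^ M} _ i)) (Fin.finToFun-funToFin _ j)
    H≡ : ∀ i → H i ≡ hue (present? i)
    H≡ = Fin.finToFun-funToFin _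
    joined⁻ : ∀ {u v} → E (ι u) (ι v) ≡ zero → Edge X u v
    joined⁻ p with bit⁻ (joined? _ _) (trans (sym (E≡ _ _)) p)
    ... | u , v , p , q , d = subst₂ (Edge X) (number-injective pt b p) (number-injective pt b q) d
    code : Any (Iso X) (codes M c)
    code = Any.map (λ { refl → relation⇒iso (λ v (i , _) → ι v ≡ i)
        (λ v → (ι v , trans (P≡ _) (bit⁺ (present? _) (v , refl))) , refl)
        (λ (i , p) → bit⁻ (present? i) (trans (sym (P≡ i)) p))
        (λ { {y = i , p} {_ , q} refl refl → cong (i ,_) (≡-irrelevant p q) })
        (λ p q → number-injective pt b (trans p (sym q)))
        (λ { refl refl d → (λ p → edge-irrefl X (subst (Edge X _) (sym (number-injective pt b p)) d)) ,
                           inj₁ (trans (E≡ _ _) (bit⁺ (joined? _ _) (_ , _ , refl , refl , d))) })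
        (λ { refl refl (_ , inj₁ p) → joined⁻ p ; refl refl (_ , inj₂ p) → edge-sym X (joined⁻ p) })
        (λ { {v} refl → trans (cong Fin.toℕ (H≡ _)) (hue-correct v (present? _)) }) })
      (∈-cartesianProductWith⁺ _ (∈-allFin (Fin.funToFin (bit ∘ present?)))
        (∈-cartesianProduct⁺ (∈-allFin (Fin.funToFin (λ i → Fin.funToFin (λ j → bit (joined? i j)))))
          (∈-allFin (Fin.funToFin (hue ∘ present?)))))

-- Exchanging cliques and stars

Invariant : (ColouredGraph → Set) → Gadget r → Set₁
Invariant E g = (∀ {X Y} → Iso X Y → E X → E Y) × (∀ {Y k} → k ≢ 0 →
  (E Y → E (Expansion.expand g k Y)) × (E (Expansion.expand g k Y) → E Y))

-- Copies of an expanded vertex form a block of `g`, which meets no block of `h`. So the blocks of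
-- `h` in the expansion consist of unexpanded vertices and come from `Y`.
free-invariant : {g : Gadget r} {h : Gadget s} → Apart g h → Invariant (Free h) g
free-invariant {g = g} {h} apart = free-iso h , λ {Y} {k} k≢0 → let open Expansion g k in
  (λ free e b → free _ (lower-block h
    (λ i eq → apart (copies-block {Y = Y} eq) b _ i (copy-≡ {Y = Y} refl refl)) b)) ,
  (λ free e b → free _ (lift-block h k≢0 b))

-- The weight of a vertex is that of all its copies in the expansion of colour k.
spread : ℕ → ℕ → (ℕ → Set) → ℕ → Set
spread r k Wt c = Σ (Fin (2 + r)) λ i → Expanding k c i × Wt (erase k c)

spread-inhabited : ∀ r k {Wt} → (∀ i → Wt i) → ∀ i → spread r k Wt i
spread-inhabited r k pt i = zero , tt , pt (erase k i)

module ExpansionBase (g : Gadget r) (avoiding : CycleAvoiding g) (k : ℕ) (Wt : ℕ → Set) (M : ℕ) where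
  open Gadget g
  open Expansion g (suc k)

  -- Weights are sets and not numbers, so that expansion preserves the total weight by reassociating
  -- pairs.
  weights : Σ (Copy Y) (λ x → Wt (erase (suc k) (colour Y (proj₁ x)))) ↔
            Σ (V Y) (spread r (suc k) Wt ∘ colour Y)
  weights = mk↔ₛ′ (λ ((y , i , a) , w) → y , i , a , w) (λ (y , i , a , w) → (y , i , a) , w)
                  (λ _ → refl) (λ _ → refl)

  to-centre : ∀ {y} i a → Star (Edge (expand Y)) (y , i , a) (y , zero , tt)
  to-centre {Y} {y} zero    a = ε
  to-centre {Y} {y} (suc i) a = inj₁ (refl , inner-sym (inner-centre i)) ◅ ε

  expand-connected⁺ : (∀ u v → Star (Edge Y) u v) → ∀ u v → Star (Edge (expand Y)) u v
  expand-connected⁺ {Y} conn (u , i , a) (v , j , b) =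
    to-centre {Y} i a ◅◅ gmap (λ y → (y , zero , tt)) (λ d → inj₂ (port-centre , port-centre , d)) (conn u v)
      ◅◅ reverse (λ {x} {y} → edge-sym (expand Y) {x} {y}) (to-centre {Y} j b)

  expand-connected⁻ : (∀ u v → Star (Edge (expand Y)) u v) → ∀ u v → Star (Edge Y) u v
  expand-connected⁻ {Y} conn u v = project (conn (u , zero , tt) (v , zero , tt))
    where
    project : ∀ {x y} → Star (Edge (expand Y)) x y → Star (Edge Y) (proj₁ x) (proj₁ y)
    project ε = ε
    project (inj₁ (refl , _) ◅ p) = project p
    project (inj₂ (_ , _ , d) ◅ p) = d ◅ project p

  cycle⁺ : Cycle ℓ Y → Cycle ℓ (expand Y)
  cycle⁺ c = record
    { at = λ i → at i , zero , tt
    ; injective = injective ∘ cong proj₁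
    ; edge⁺ = λ d → inj₂ (port-centre , port-centre , edge⁺ d)
    ; edge⁻ = λ { (inj₁ (_ , d)) → contradiction d inner-irrefl ; (inj₂ (_ , _ , d)) → edge⁻ d } }
    where open Cycle c

  -- The projection to `Y` is injective because the cycle has no two vertices in one block, and it
  -- reflects edges because the cycle enters blocks only at ports.
  cycle⁻ : 4 ≤ ℓ → Cycle ℓ (expand Y) → Cycle ℓ Y
  cycle⁻ {ℓ} {Y} 4≤ℓ c = record
    { at = vertex
    ; injective = λ {i} {j} → vertex-injective {i} {j}
    ; edge⁺ = λ {i} {j} d → case edge⁺ d of λ
        { (inj₁ (p , _)) → contradiction (subst (λ i → Edge (expand Y) (at i) (at j)) (vertex-injective {i} {j} p) (edge⁺ d))
                             (edge-irrefl (expand Y) {at j})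
        ; (inj₂ (_ , _ , d)) → d }
    ; edge⁻ = λ d → edge⁻ (inj₂ (port _ , port _ , d)) }
    where
    open Cycle c
    vertex : Fin ℓ → V Y
    vertex = proj₁ ∘ at
    copy : Fin ℓ → Fin (2 + r)
    copy = proj₁ ∘ proj₂ ∘ at
    port : ∀ a → Port (copy a)
    port a with colour Y (vertex a) ℕ.≟ suc k
    ... | yes eq = proj₁ (avoiding 4≤ℓ (copies-block {Y = Y} eq) c) a _ (copy-≡ {Y = Y} refl refl)
    ... | no ≢k  = subst Port (sym (expanding-≢ (copy a) ≢k (proj₂ (proj₂ (at a))))) port-centre
    same-copy : ∀ {a b} → vertex a ≡ vertex b → copy a ≡ copy b
    same-copy {a} {b} p with colour Y (vertex b) ℕ.≟ suc k
    ... | yes eq = proj₂ (avoiding 4≤ℓ (copies-block {Y = Y} eq) c) a b _ _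
      (copy-≡ {Y = Y} p refl) (copy-≡ {Y = Y} refl refl)
    ... | no ≢k  = trans (expanding-≢ (copy a) (≢k ∘ trans (cong (colour Y) (sym p))) (proj₂ (proj₂ (at a))))
                         (sym (expanding-≢ (copy b) ≢k (proj₂ (proj₂ (at b)))))
    vertex-injective : ∀ {a b} → vertex a ≡ vertex b → a ≡ b
    vertex-injective {a} {b} p = injective (copy-≡ {Y = Y} p (same-copy {a} {b} p))

  occurs≢ : (i : Fin k) → suc (Fin.toℕ i) ≢ suc k
  occurs≢ i eq = ℕ.<⇒≢ (Fin.toℕ<n i) (ℕ.suc-injective eq)

  -- The parameters `suc k` and `k` of the source say that the fresh colour may be used but need not
  -- be.
  base⁺ : Base (suc k) k (spread r (suc k) Wt) M Y → Base k k Wt M (expand Y)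
  base⁺ {Y} b = record
    { small = λ (v , _) → erase-small (small v)
    ; occurs = λ i → let v , p = occurs i in
        (v , zero , tt) , trans (erase-≢ (λ eq → occurs≢ i (trans (sym p) eq))) p
    ; weight = weight ↔-∘ weights {Y}
    ; connected = expand-connected⁺ {Y} connected
    ; cycle-free = λ ℓ 4≤ℓ c → cycle-free ℓ 4≤ℓ (cycle⁻ 4≤ℓ c)
    }
    where
    open Base b
    erase-small : ∀ {c} → c ≤ suc k → erase (suc k) c ≤ k
    erase-small {c} c≤ with c ℕ.≟ suc k
    ... | yes _ = z≤n
    ... | no ≢k = ℕ.≤-pred (ℕ.≤∧≢⇒< c≤ ≢k)

  base⁻ : Base k k Wt M (expand Y) → Base (suc k) k (spread r (suc k) Wt) M Y
  base⁻ {Y} b = record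
    { small = λ v → erase-small (small (v , zero , tt))
    ; occurs = λ i → let (v , _) , p = occurs i in v , erase-suc p
    ; weight = weight ↔-∘ ↔-sym (weights {Y})
    ; connected = expand-connected⁻ {Y} connected
    ; cycle-free = λ ℓ 4≤ℓ c → cycle-free ℓ 4≤ℓ (cycle⁺ c)
    }
    where
    open Base b
    erase-small : ∀ {c} → erase (suc k) c ≤ k → c ≤ suc k
    erase-small {c} c≤ with c ℕ.≟ suc k
    ... | yes eq = ℕ.≤-reflexive eq
    ... | no _   = ℕ.m≤n⇒m≤1+n c≤
    erase-suc : ∀ {c i} → erase (suc k) c ≡ suc i → c ≡ suc i
    erase-suc {c} p with c ℕ.≟ suc k
    ... | no _ = p

  -- Without vertices of the fresh colour the graph is isomorphic to its expansion, so `spread` and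
  -- `Wt` give the same total weight.
  base-unmarked⁺ : (∀ v → colour Y v ≢ suc k) → Base (suc k) k (spread r (suc k) Wt) M Y → Base k k Wt M Y
  base-unmarked⁺ unmarked b = base-iso (iso-sym (expand-unmarked unmarked)) (base⁺ b)

  base-unmarked⁻ : (∀ v → colour Y v ≢ suc k) → Base k k Wt M Y → Base (suc k) k (spread r (suc k) Wt) M Y
  base-unmarked⁻ unmarked b = base⁻ (base-iso (expand-unmarked unmarked) b)

  unmarked : Base k k Wt M Y → ∀ v → colour Y v ≢ suc k
  unmarked b v eq = ℕ.<-irrefl refl (subst (_≤ k) eq (Base.small b v))

  base-marked⁺ : ∃ (λ v → colour Y v ≡ suc k) → Base (suc k) k (spread r (suc k) Wt) M Y →
                 Base (suc k) (suc k) (spread r (suc k) Wt) M Y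
  base-marked⁺ {Y} (v , eq) b = record { Base b ; occurs = all }
    where
    all : ∀ (i : Fin (suc k)) → ∃ λ v → colour Y v ≡ suc (Fin.toℕ i)
    all i with Fin.toℕ i ℕ.≟ k
    ... | yes p = v , trans eq (cong suc (sym p))
    ... | no ≢k = let w , q = Base.occurs b (Fin.lower₁ i (≢k ∘ sym)) in
                  w , trans q (cong suc (Fin.toℕ-lower₁ i (≢k ∘ sym)))

  base-marked⁻ : Base (suc k) (suc k) (spread r (suc k) Wt) M Y → Base (suc k) k (spread r (suc k) Wt) M Y
  base-marked⁻ b = record { Base b ; occurs = λ i → let v , p = Base.occurs b (Fin.inject₁ i) in
    v , trans p (cong suc (Fin.toℕ-inject₁ i)) }

  marked : Base (suc k) (suc k) (spread r (suc k) Wt) M Y → ∃ λ v → colour Y v ≡ suc k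
  marked b = let v , p = Base.occurs b (Fin.fromℕ k) in v , trans p (cong suc (Fin.toℕ-fromℕ k))

-- Expanding the vertices of the fresh colour k + 1 identifies the classes with E on the left with the
-- block-free classes on at most k + 1 colours; these are split according to whether k + 1 occurs.
count-split : (g : Gadget r) → Conjugate g → CycleAvoiding g → (E : ColouredGraph → Set) → Invariant E g →
  ∀ k {Wt M} → (∀ i → Wt i) → ∀ {xs ys zs} →
  Reps (λ X → E X × Base k k Wt M X) xs →
  Reps (λ X → (E X × Free g X) × Base k k Wt M X) ys →
  Reps (λ X → (E X × Free g X) × Base (suc k) (suc k) (spread r (suc k) Wt) M X) zs →
  length xs ≡ length ys + length zs
count-split {r} g conj avoiding E (E-iso , E-expand) k {Wt} {M} pt {xs} {ys} {zs} reps-xs reps-ys reps-zs = trans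
  (length-bijection expand
    (λ ((e , _) , b) → proj₁ (E-expand λ ()) e , base⁺ b)
    expand-iso
    (λ {Y} {Y′} ((_ , free) , b) ((_ , free′) , b′) f → do
      vs , all ← listed (spread-inhabited r (suc k) pt) b
      return (expand-injective conj vs all (λ v → protected b v) (λ v → protected b′ v) free free′ f))
    -- Surjectivity: `X` lacks the fresh colour, hence is its own expansion, which `normalise` turns
    -- into the expansion of a block-free graph.
    (λ {X} (e , b) → do
      Y , free , f ← normalise (λ ()) M X (number pt b) (number-injective pt b)
      let X≅ = iso-trans (expand-unmarked (unmarked b)) f
      return (Y , ((proj₂ (E-expand λ ()) (E-iso X≅ e) , free) , base⁻ (base-iso X≅ b)) , X≅))
    reps-xs
    (reps-++ (λ { f ((e , free) , b) → (E-iso f e , free-iso g f free) , base-iso f b })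
      (λ (e , b) → e , base-unmarked⁻ (unmarked b) b)
      (λ (e , b) → e , base-marked⁻ b)
      (λ (e , b) → ¬¬-excluded-middle >>= λ
        { (yes m) → return (inj₂ (e , base-marked⁺ m b))
        ; (no ¬m) → return (inj₁ (e , base-unmarked⁺ (λ v eq → ¬m (v , eq)) b)) })
      (λ (_ , b) (_ , b′) → let v , eq = marked b′ in unmarked b v eq)
      reps-ys reps-zs))
  (List.length-++ ys)
  where
  open Expansion g (suc k)
  open Injectivity g (suc k)
  open ExpansionBase g avoiding k Wt M
  protected : ∀ {Y} → Base (suc k) k (spread r (suc k) Wt) M Y → ∀ v → colour Y v ≢ suc (suc k)
  protected b v eq = ℕ.<-irrefl refl (subst (_≤ suc k) eq (Base.small b v))

reps-base : ∀ (E : ColouredGraph → Set) {c k Wt M} → (∀ {X Y} → Iso X Y → E X → E Y) → (∀ i → Wt i) →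
            ¬ ¬ ∃ (Reps (λ X → E X × Base c k Wt M X))
reps-base E {c} {M = M} E-iso pt =
  reps-exist (λ f (e , b) → E-iso f e , base-iso f b) (codes M c) (λ _ (_ , b) → base-coded pt b)

reps-resp : {P Q : ColouredGraph → Set} → (∀ {X} → P X → Q X) → (∀ {X} → Q X → P X) →
            ∀ {xs} → Reps P xs → Reps Q xs
reps-resp P⊆Q Q⊆P reps = record
  { sound = All.map P⊆Q sound ; distinct = distinct ; complete = λ X q → complete X (Q⊆P q) }
  where open Reps reps

reps-overweight : ∀ (E : ColouredGraph → Set) {k Wt M} → (∀ i → Wt i) → M < k →
                  ∀ {xs} → Reps (λ X → E X × Base k k Wt M X) xs → length xs ≡ 0
reps-overweight E pt M<k {[]}     _    = refl
reps-overweight E pt M<k {X ∷ xs} reps with _ , b ← All.head (Reps.sound reps) =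
  contradiction (colours≤weight pt b) (ℕ.<⇒≱ M<k)

-- Both sides satisfy the recursion of count-split, with the same left-hand side. It ends since all
-- of the colours 1, …, k are used, so that k ≤ M.
exchange-one : ∀ d k {Wt M} → (∀ i → Wt i) → M < k + d → ∀ {xs ys} →
  Reps (λ X → (⊤ × Free (clique r) X) × Base k k Wt M X) xs →
  Reps (λ X → (⊤ × Free (star r) X) × Base k k Wt M X) ys → length xs ≡ length ys
exchange-one {r} zero k pt M< reps-xs reps-ys = trans
  (reps-overweight (λ X → ⊤ × Free (clique r) X) pt (subst (_ <_) (ℕ.+-identityʳ k) M<) reps-xs)
  (sym (reps-overweight (λ X → ⊤ × Free (star r) X) pt (subst (_ <_) (ℕ.+-identityʳ k) M<) reps-ys))
exchange-one {r} (suc d) k {Wt} {M} pt M< {xs} {ys} reps-xs reps-ys = decidable-stable (length xs ℕ.≟ length ys) do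
  us , reps-us ← reps-base (λ _ → ⊤) {k} {k} {Wt} {M} (λ _ _ → tt) pt
  zs , reps-zs ← reps-base (λ X → ⊤ × Free (clique r) X) (λ f (_ , free) → tt , free-iso (clique r) f free) pt′
  zs′ , reps-zs′ ← reps-base (λ X → ⊤ × Free (star r) X) (λ f (_ , free) → tt , free-iso (star r) f free) pt′
  let same = exchange-one d (suc k) pt′ (subst (M <_) (ℕ.+-suc k d) M<) reps-zs reps-zs′
  return (ℕ.+-cancelʳ-≡ (length zs) (length xs) (length ys) (trans
    (sym (count-split (clique r) clique-conjugate clique-avoiding (λ _ → ⊤) (top {clique r}) k pt reps-us reps-xs reps-zs)) (trans
    (count-split (star r) star-conjugate star-avoiding (λ _ → ⊤) (top {star r}) k pt reps-us reps-ys reps-zs′)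
    (cong (length ys +_) (sym same)))))
  where
  pt′ = spread-inhabited r (suc k) pt
  top : {g : Gadget r} → Invariant (λ _ → ⊤) g
  top = (λ _ _ → tt) , λ _ → (λ _ → tt) , (λ _ → tt)

-- Blocks of size 2 + r are contracted while blocks of the opposite kind and size 2 + s stay
-- forbidden. The two recursions start from different classes, free of stars or free of cliques of
-- size 2 + s, and `exchange-one` shows that these have equally many members.
exchange-two : r ≢ s → ∀ d k {Wt M} → (∀ i → Wt i) → M < k + d → ∀ {xs ys} →
  Reps (λ X → (Free (star s) X × Free (clique r) X) × Base k k Wt M X) xs →
  Reps (λ X → (Free (clique s) X × Free (star r) X) × Base k k Wt M X) ys → length xs ≡ length ys
exchange-two {r} {s} r≢s zero k pt M< reps-xs reps-ys = trans
  (reps-overweight (λ X → Free (star s) X × Free (clique r) X) pt (subst (_ <_) (ℕ.+-identityʳ k) M<) reps-xs)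
  (sym (reps-overweight (λ X → Free (clique s) X × Free (star r) X) pt (subst (_ <_) (ℕ.+-identityʳ k) M<) reps-ys))
exchange-two {r} {s} r≢s (suc d) k {Wt} {M} pt M< {xs} {ys} reps-xs reps-ys = decidable-stable (length xs ℕ.≟ length ys) do
  us , reps-us ← reps-base (Free (star s)) {k = k} (free-iso (star s)) pt
  us′ , reps-us′ ← reps-base (Free (clique s)) {k = k} (free-iso (clique s)) pt
  zs , reps-zs ← reps-base (λ X → Free (star s) X × Free (clique r) X)
    (λ f (e , free) → free-iso (star s) f e , free-iso (clique r) f free) pt′
  zs′ , reps-zs′ ← reps-base (λ X → Free (clique s) X × Free (star r) X)
    (λ f (e , free) → free-iso (clique s) f e , free-iso (star r) f free) pt′
  let same = exchange-two r≢s d (suc k) pt′ (subst (M <_) (ℕ.+-suc k d) M<) reps-zs reps-zs′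
      same′ = exchange-one (suc d) k pt M< (with-⊤ (Free (clique s)) reps-us′) (with-⊤ (Free (star s)) reps-us)
  return (ℕ.+-cancelʳ-≡ (length zs) (length xs) (length ys) (trans
    (sym (count-split (clique r) clique-conjugate clique-avoiding (Free (star s))
      (free-invariant (clique-star-apart r≢s)) k pt reps-us reps-xs reps-zs)) (trans
    (sym same′) (trans
    (count-split (star r) star-conjugate star-avoiding (Free (clique s))
      (free-invariant (λ b b′ i j p → clique-star-apart (r≢s ∘ sym) b′ b j i (sym p))) k pt reps-us′ reps-ys reps-zs′)
    (cong (length ys +_) (sym same))))))
  where
  pt′ = spread-inhabited r (suc k) pt
  with-⊤ : ∀ (E : ColouredGraph → Set) {xs} → Reps (λ X → E X × Base k k Wt M X) xs →
           Reps (λ X → (⊤ × E X) × Base k k Wt M X) xs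
  with-⊤ E = reps-resp (λ (e , b) → (tt , e) , b) (λ ((_ , e) , b) → e , b)

-- Graphs without colours

T⇔⇒≡ : ∀ {a b} → (T a → T b) → (T b → T a) → a ≡ b
T⇔⇒≡ {true}  {true}  f g = refl
T⇔⇒≡ {false} {false} f g = refl
T⇔⇒≡ {true}  {false} f g = ⊥-elim (f tt)
T⇔⇒≡ {false} {true}  f g = ⊥-elim (g tt)

T-does⁻ : {A : Set} (d : Dec A) → T (does d) → A
T-does⁻ (yes a) _ = a

T-does⁺ : {A : Set} (d : Dec A) → A → T (does d)
T-does⁺ (yes _) _ = tt
T-does⁺ (no ¬a) a = ¬a a

support : (p : Fin m → Bool) → (∃ λ i → T (p i)) ↔ Fin ∣ tabulate p ∣
support {zero}  p = mk↔ₛ′ (λ ()) (λ ()) (λ ()) λ ()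
support {suc m} p with p zero in eq | support (p ∘ suc)
... | true  | tail = mk↔ₛ′
  (λ { (zero , _) → zero ; (suc i , t) → suc (Inverse.to tail (i , t)) })
  (λ { zero → zero , subst T (sym eq) tt ; (suc j) → let i , t = Inverse.from tail j in suc i , t })
  (λ { zero → refl ; (suc j) → cong suc (Inverse.strictlyInverseˡ tail j) })
  (λ { (zero , t) → cong (zero ,_) (T-irrelevant _ t)
     ; (suc i , t) → cong (λ (i , t) → suc i , t) (Inverse.strictlyInverseʳ tail (i , t)) })
... | false | tail = mk↔ₛ′
  (λ { (zero , t) → ⊥-elim (subst T eq t) ; (suc i , t) → Inverse.to tail (i , t) })
  (λ j → let i , t = Inverse.from tail j in suc i , t)
  (λ j → Inverse.strictlyInverseˡ tail j)
  (λ { (zero , t) → ⊥-elim (subst T eq t)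
     ; (suc i , t) → cong (λ (i , t) → suc i , t) (Inverse.strictlyInverseʳ tail (i , t)) })

module _ (p : Fin m → Bool) where
  open Inverse (support p)

  private
    supported-≡ : ∀ {x y : ∃ λ i → T (p i)} → proj₁ x ≡ proj₁ y → x ≡ y
    supported-≡ {i , t} {.i , t′} refl = cong (i ,_) (T-irrelevant t t′)

    to-injective : ∀ {x y} → to x ≡ to y → proj₁ x ≡ proj₁ y
    to-injective eq = cong proj₁ (trans (sym (strictlyInverseʳ _)) (trans (cong from eq) (strictlyInverseʳ _)))

    from-injective : ∀ {i j} → proj₁ (from i) ≡ proj₁ (from j) → i ≡ j
    from-injective {i} {j} eq = trans (sym (strictlyInverseˡ i)) (trans (cong to (supported-≡ eq)) (strictlyInverseˡ j))

  tuple⇒≤ : (e : Fin n → Fin m) → (∀ {i j} → e i ≡ e j → i ≡ j) → (∀ i → T (p (e i))) → n ≤ ∣ tabulate p ∣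
  tuple⇒≤ e inj t = Fin.injective⇒≤ {f = λ i → to (e i , t i)} (inj ∘ to-injective)

  ≤⇒tuple : n ≤ ∣ tabulate p ∣ → ∃ λ (e : Fin n → Fin m) → (∀ {i j} → e i ≡ e j → i ≡ j) × (∀ i → T (p (e i)))
  ≤⇒tuple n≤ = (λ i → proj₁ (from (Fin.inject≤ i n≤))) ,
    (λ eq → Fin.inject≤-injective n≤ n≤ _ _ (from-injective eq)) , λ i → proj₂ (from (Fin.inject≤ i n≤))

  single⇒unique : ∣ tabulate p ∣ ≡ 1 → ∀ {u v} → T (p u) → T (p v) → u ≡ v
  single⇒unique one {u} {v} s t = to-injective {u , s} {v , t} (fin1 one _ _)
    where
    fin1 : ∀ {n} → n ≡ 1 → (i j : Fin n) → i ≡ j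
    fin1 refl zero zero = refl

  unique⇒single : ∀ {v} → T (p v) → (∀ u → T (p u) → u ≡ v) → ∣ tabulate p ∣ ≡ 1
  unique⇒single {v} t only = ℕ.≤-antisym
    (Fin.injective⇒≤ {f = λ (_ : Fin ∣ tabulate p ∣) → zero {0}}
      (λ _ → from-injective (trans (only _ (proj₂ (from _))) (sym (only _ (proj₂ (from _)))))))
    (tuple⇒≤ (λ _ → v) (λ { {zero} {zero} _ → refl }) (λ _ → t))

maxOver⁻ : ∀ (f : Fin m → ℕ) {b} → maxOver f ≤ b → ∀ v → f v ≤ b
maxOver⁻ {suc m} f max≤ zero    = ℕ.≤-trans (ℕ.m≤m⊔n _ _) max≤
maxOver⁻ {suc m} f max≤ (suc v) = maxOver⁻ (f ∘ suc) (ℕ.≤-trans (ℕ.m≤n⊔m (f zero) _) max≤) v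

maxOver⁺ : ∀ (f : Fin m → ℕ) {b} → (∀ v → f v ≤ b) → maxOver f ≤ b
maxOver⁺ {zero}  f f≤ = z≤n
maxOver⁺ {suc m} f f≤ = ℕ.⊔-lub (f≤ zero) (maxOver⁺ (f ∘ suc) (f≤ ∘ suc))

uncoloured : Graph m → ColouredGraph
uncoloured {m} G = record
  { V = Fin m ; _≟_ = Fin._≟_ ; Edge = Adj G
  ; edge-sym = λ {u} {v} → subst T (adj-sym G u v)
  ; edge-irrefl = λ {v} → subst T (adj-irrefl G v)
  ; colour = λ _ → 0 }

≅⇒iso : {G : Graph m} {H : Graph n} → G ≅ H → Iso (uncoloured G) (uncoloured H)
≅⇒iso (iso bij eq) = record
  { to = to ; from = from ; from-to = strictlyInverseʳ ; to-from = strictlyInverseˡ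
  ; edge⁺ = subst T (eq _ _) ; edge⁻ = subst T (sym (eq _ _)) ; colour-to = λ _ → refl }
  where open Inverse bij

iso⇒≅ : {G : Graph m} {H : Graph n} → Iso (uncoloured G) (uncoloured H) → G ≅ H
iso⇒≅ f = iso (mk↔ₛ′ to from to-from from-to) (λ u v → T⇔⇒≡ edge⁺ edge⁻)
  where open Iso f

embedding⇒cycle : {G : Graph m} → HasInducedCycle ℓ G → Cycle ℓ (uncoloured G)
embedding⇒cycle (embedding to injective adj-≡) = record
  { at = to ; injective = injective ; edge⁺ = subst T (adj-≡ _ _) ; edge⁻ = subst T (sym (adj-≡ _ _)) }

cycle⇒embedding : {G : Graph m} → Cycle ℓ (uncoloured G) → HasInducedCycle ℓ G
cycle⇒embedding c = embedding at injective (λ _ _ → T⇔⇒≡ edge⁺ edge⁻)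
  where open Cycle c

module _ (G : Graph m) where
  private
    edge-sym′ : ∀ {u v} → Adj G u v → Adj G v u
    edge-sym′ {u} {v} = edge-sym (uncoloured G) {u} {v}

    edge-irrefl′ : ∀ {u v} → u ≡ v → ¬ Adj G u v
    edge-irrefl′ {u} refl = edge-irrefl (uncoloured G) {u}

  leaf-unique : ∀ {v} → Leaf G v → ∀ {u w} → Adj G v u → Adj G v w → u ≡ w
  leaf-unique {v} leaf = single⇒unique (adj G v) leaf

  leaf⁺ : ∀ {u v} → Leaf-of (uncoloured G) u v → Leaf G v
  leaf⁺ {u} {v} (uv , only) = unique⇒single (adj G v) (edge-sym′ uv) (λ w vw → only w (edge-sym′ vw))

  ∈N[]⁻ : ∀ {u v} → v ∈ₛ N[_] G u → v ≡ u ⊎ Adj G u v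
  ∈N[]⁻ {u} {v} v∈ with x∈p∪q⁻ ⁅ u ⁆ (N G u) v∈
  ... | inj₁ p = inj₁ (x∈⁅y⁆⇒x≡y u p)
  ... | inj₂ p = inj₂ (subst T (trans (sym ([]=⇒lookup p)) (lookup∘tabulate (adj G u) v)) tt)

  ∈N[]⁺ : ∀ {u v} → v ≡ u ⊎ Adj G u v → v ∈ₛ N[_] G u
  ∈N[]⁺ (inj₁ refl) = x∈p∪q⁺ (inj₁ (x∈⁅x⁆ _))
  ∈N[]⁺ {u} {v} (inj₂ p) = x∈p∪q⁺ {p = ⁅ u ⁆} (inj₂ (lookup⇒[]= v (N G u)
    (trans (lookup∘tabulate (adj G u) v) (Equivalence.to T-≡ p))))

  same-adj : ∀ {u v w} → SameN[] G u v → w ≢ v → Adj G w u → Adj G w v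
  same-adj {u} {v} {w} same w≢v wu with ∈N[]⁻ (subst (w ∈ₛ_) same (∈N[]⁺ (inj₂ (edge-sym′ wu))))
  ... | inj₁ w≡v = contradiction w≡v w≢v
  ... | inj₂ vw  = edge-sym′ vw

  same-joined : ∀ {u v} → SameN[] G u v → u ≢ v → Adj G u v
  same-joined {u} same u≢v with ∈N[]⁻ (subst (u ∈ₛ_) same (∈N[]⁺ (inj₁ refl)))
  ... | inj₁ u≡v = contradiction u≡v u≢v
  ... | inj₂ vu  = edge-sym′ vu

  same⁺ : ∀ {u v} → Adj G u v → Dominates (uncoloured G) u v → Dominates (uncoloured G) v u → SameN[] G u v
  same⁺ {u} {v} uv u≤v v≤u = ⊆-antisym (⊆ uv u≤v) (⊆ (edge-sym′ uv) v≤u)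
    where
    ⊆ : ∀ {u v} → Adj G u v → Dominates (uncoloured G) u v → ∀ {w} → w ∈ₛ N[_] G u → w ∈ₛ N[_] G v
    ⊆ {u} {v} uv dom {w} w∈ with w Fin.≟ v | ∈N[]⁻ w∈
    ... | yes w≡v | _         = ∈N[]⁺ (inj₁ w≡v)
    ... | no _    | inj₁ refl = ∈N[]⁺ (inj₂ (edge-sym′ uv))
    ... | no w≢v  | inj₂ uw   = ∈N[]⁺ (inj₂ (edge-sym′ (dom w w≢v (edge-sym′ uw))))

  private
    siblings-of : Fin m → Fin m → Bool
    siblings-of v u = does (sameN[]? G u v)

    leaves-at : Fin m → Fin m → Bool
    leaves-at v u = does (leaf? G u) ∧ adj G v u

  sibling≤⇒free : ∀ {a} → siblingNumber G ≤ a → Free (clique a) (uncoloured G)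
  sibling≤⇒free {a} s≤a e b = ℕ.<⇒≱
    (tuple⇒≤ (siblings-of (e zero)) e injective (λ i → T-does⁺ (sameN[]? G _ _) (same i)))
    -- `siblingNumber` is one less than the largest class, so the bound `a` allows classes of
    -- `suc a` vertices, one fewer than a block has.
    (maxOver⁻ (λ v → ∣ tabulate (siblings-of v) ∣) (ℕ.≤-trans (ℕ.m≤n+m∸n _ 1) (s≤s s≤a)) (e zero))
    where
    open Block b
    same : ∀ i → SameN[] G (e i) (e zero)
    same i with i Fin.≟ zero
    ... | yes refl = refl
    ... | no i≢0 = same⁺ (inner⁺ i≢0) (clique-dominates b i zero) (clique-dominates b zero i)

  free⇒sibling≤ : ∀ {a} → Free (clique a) (uncoloured G) → siblingNumber G ≤ a
  free⇒sibling≤ {a} free = ℕ.m≤n+o⇒m∸n≤o (maxOver (λ v → ∣ tabulate (siblings-of v) ∣)) 1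
    (maxOver⁺ (λ v → ∣ tabulate (siblings-of v) ∣) (λ v → ℕ.≮⇒≥ (λ a<∣∣ →
      let e , inj , t = ≤⇒tuple (siblings-of v) a<∣∣
          same : ∀ i j → SameN[] G (e i) (e j)
          same i j = trans (T-does⁻ (sameN[]? G _ _) (t i)) (sym (T-does⁻ (sameN[]? G _ _) (t j)))
      in free e record
        { injective = inj
        ; colour-zero = λ _ → refl
        ; inner⁺ = λ i≢j → same-joined (same _ _) (i≢j ∘ inj)
        ; inner⁻ = λ d i≡j → edge-irrefl′ (cong e i≡j) d
        ; outer⁺ = λ out _ d → same-adj (same zero _) (out _) d
        ; outer⁻ = λ out {i} d → tt , same-adj (same i zero) (out zero) d })))

  tuft≤⇒free : ∀ {b} → tuftNumber G ≤ b → Free (star b) (uncoloured G)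
  tuft≤⇒free {b} t≤b e block = ℕ.<⇒≱
    (tuple⇒≤ (leaves-at (e zero)) (e ∘ suc) (Fin.suc-injective ∘ injective)
      (λ i → Equivalence.from T-∧ (T-does⁺ (leaf? G _) (leaf⁺ (star-leaf block i)) , inner⁺ tt)))
    (maxOver⁻ (λ v → ∣ tabulate (leaves-at v) ∣) t≤b (e zero))
    where open Block block

  free⇒tuft≤ : ∀ {b} → Free (star b) (uncoloured G) → tuftNumber G ≤ b
  free⇒tuft≤ {b} free = maxOver⁺ (λ v → ∣ tabulate (leaves-at v) ∣) (λ v → ℕ.≮⇒≥ (λ b<∣∣ →
    let e , inj , t = ≤⇒tuple (leaves-at v) b<∣∣
        leaf : ∀ i → Leaf G (e i)
        leaf i = T-does⁻ (leaf? G _) (proj₁ (Equivalence.to T-∧ (t i)))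
        joined : ∀ i → Adj G v (e i)
        joined i = proj₂ (Equivalence.to (T-∧ {does (leaf? G _)}) (t i))
        only : ∀ i {w} → Adj G w (e i) → w ≡ v
        only i wi = leaf-unique (leaf i) (edge-sym′ wi) (edge-sym′ (joined i))
        tuple : Fin (suc (suc b)) → Fin m
        tuple = λ { zero → v ; (suc i) → e i }
    in free tuple record
      { injective = λ { {zero} {zero} _ → refl
                      ; {zero} {suc j} p → contradiction (joined j) (edge-irrefl′ p)
                      ; {suc i} {zero} p → contradiction (joined i) (edge-irrefl′ (sym p))
                      ; {suc i} {suc j} p → cong suc (inj p) }
      ; colour-zero = λ _ → refl
      ; inner⁺ = λ { {zero} {suc j} _ → joined j ; {suc i} {zero} _ → edge-sym′ (joined i) }
      ; inner⁻ = λ { {zero} {zero} d → edge-irrefl′ refl d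
                   ; {zero} {suc j} d → tt
                   ; {suc i} {zero} d → tt
                   ; {suc i} {suc j} d → edge-irrefl′ (sym (only j d)) (joined i) }
      ; outer⁺ = λ { out {zero} _ d → d }
      ; outer⁻ = λ { out {zero} d → tt , d ; out {suc i} d → contradiction (only i d) (out zero) } }))

-- Induced cycles under reduction steps

leafless-cycle : {G : Graph m} {H : Graph n} → 4 ≤ ℓ → RemovesLeaves G H →
                 Cycle ℓ (uncoloured G) ⇔ Cycle ℓ (uncoloured H)
leafless-cycle {ℓ = ℓ} {G = G} {H} 4≤ℓ record { incl = embedding to inj adj-≡ ; image = image } = mk⇔ down up
  where
  up : Cycle ℓ (uncoloured H) → Cycle ℓ (uncoloured G)
  up c = record { at = to ∘ at ; injective = injective ∘ inj
                ; edge⁺ = subst T (adj-≡ _ _) ∘ edge⁺ ; edge⁻ = edge⁻ ∘ subst T (sym (adj-≡ _ _)) }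
    where open Cycle c
  down : Cycle ℓ (uncoloured G) → Cycle ℓ (uncoloured H)
  down c = record
    { at = proj₁ ∘ preimage
    ; injective = λ {i} {j} p → injective (trans (sym (eq i)) (trans (cong to p) (eq j)))
    ; edge⁺ = λ {i} {j} d → subst T (sym (adj-≡ _ _)) (subst₂ (Adj G) (sym (eq i)) (sym (eq j)) (edge⁺ d))
    ; edge⁻ = λ {i} {j} d → edge⁻ (subst₂ (Adj G) (eq i) (eq j) (subst T (adj-≡ _ _) d)) }
    where
    open Cycle c
    preimage : ∀ i → ∃ λ u → to u ≡ at i
    preimage i = Equivalence.to (image (at i)) λ leaf →
      let j , w , ij , iw , w≢j = C-two-neighbours 4≤ℓ i
      in w≢j (injective (leaf-unique G leaf (edge⁺ iw) (edge⁺ ij)))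
    eq : ∀ i → to (proj₁ (preimage i)) ≡ at i
    eq i = proj₂ (preimage i)

-- Downwards, two siblings on the cycle would be joined and dominate each other, which an induced
-- cycle excludes. Upwards, any choice of representatives of the classes gives an induced cycle.
contracted-cycle : {G : Graph m} {H : Graph n} → 4 ≤ ℓ → ContractsSiblings G H →
                   Cycle ℓ (uncoloured G) ⇔ Cycle ℓ (uncoloured H)
contracted-cycle {ℓ = ℓ} {G = G} {H} 4≤ℓ contraction = mk⇔ down up
  where
  open ContractsSiblings contraction
  sym′ : ∀ {u v} → Adj G u v → Adj G v u
  sym′ {u} {v} = edge-sym (uncoloured G) {u} {v}
  same : ∀ {u v} → π u ≡ π v → SameN[] G u v
  same = Equivalence.to (fibres _ _)
  -- An edge between classes joins some two representatives; equal closed neighbourhoods allow each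
  -- end to be replaced by any other member of its class.
  lift : ∀ {u v} → u ≢ v → Adj H (π u) (π v) → Adj G u v
  lift {u} {v} u≢v d =
    let πu≢πv , u′ , v′ , pu , pv , d′ = Equivalence.to (edges (π u) (π v)) d
        vu′ = sym′ (same-adj G (same pv) (λ u′≡v → πu≢πv (trans (sym pu) (cong π u′≡v))) d′)
    in sym′ (same-adj G (same pu) (u≢v ∘ sym) vu′)
  down : Cycle ℓ (uncoloured G) → Cycle ℓ (uncoloured H)
  down c = record
    { at = π ∘ at
    ; injective = π-injective
    ; edge⁺ = λ {i} {j} d → Equivalence.from (edges _ _)
        ((λ p → edge-irrefl (uncoloured G) (subst (λ j → Adj G (at i) (at j)) (sym (π-injective p)) (edge⁺ d))) ,
         at i , at j , refl , refl , edge⁺ d)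
    ; edge⁻ = λ {i} {j} d → edge⁻ (lift (λ p → proj₁ (Equivalence.to (edges _ _) d) (cong π p)) d) }
    where
    open Cycle c
    π-injective : ∀ {i j} → π (at i) ≡ π (at j) → i ≡ j
    π-injective {i} {j} p with i Fin.≟ j
    ... | yes i≡j = i≡j
    ... | no i≢j  = contradiction (λ w → same-adj G (same p))
      (cycle-undominated (uncoloured G) 4≤ℓ c (same-joined G (same p) (i≢j ∘ injective)))
  up : Cycle ℓ (uncoloured H) → Cycle ℓ (uncoloured G)
  up c = record
    { at = section ∘ at
    ; injective = λ {i} {j} p → injective (section-injective p)
    ; edge⁺ = λ {i} {j} d →
        let d′ = subst₂ (Adj H) (sym (π-section (at i))) (sym (π-section (at j))) (edge⁺ d) in
        lift (λ p → proj₁ (Equivalence.to (edges _ _) d′) (cong π p)) d′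
    ; edge⁻ = λ {i} {j} d → edge⁻ (Equivalence.from (edges _ _)
        ((λ p → edge-irrefl (uncoloured G) (subst (λ v → Adj G (section (at i)) (section v)) (sym p) d)) ,
         section (at i) , section (at j) , π-section _ , π-section _ , d)) }
    where
    open Cycle c
    section : _ → _
    section y = proj₁ (surjective y)
    π-section : ∀ y → π (section y) ≡ y
    π-section y = proj₂ (surjective y) refl
    section-injective : ∀ {x y} → section x ≡ section y → x ≡ y
    section-injective {x} {y} p = trans (sym (π-section x)) (trans (cong π p) (π-section y))

reduction-cycle : {G : Graph m} {R : Graph k} → 4 ≤ ℓ → G ↠ R → Cycle ℓ (uncoloured G) ⇔ Cycle ℓ (uncoloured R)
reduction-cycle 4≤ℓ done = mk⇔ id id
reduction-cycle 4≤ℓ (removeLeaves step rest) = mk⇔ (R.to ∘ S.to) (S.from ∘ R.from)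
  where
  module S = Equivalence (leafless-cycle 4≤ℓ step)
  module R = Equivalence (reduction-cycle 4≤ℓ rest)
reduction-cycle 4≤ℓ (contractSiblings step rest) = mk⇔ (R.to ∘ S.to) (S.from ∘ R.from)
  where
  module S = Equivalence (contracted-cycle 4≤ℓ step)
  module R = Equivalence (reduction-cycle 4≤ℓ rest)

-- Counting

base⁺ : (G : Graph m) → Connected G → Chordal G → Base 0 0 (λ _ → ⊤) m (uncoloured G)
base⁺ G (_ , conn) chordal = record
  { small = λ _ → z≤n ; occurs = λ ()
  ; weight = mk↔ₛ′ proj₁ (_, tt) (λ _ → refl) (λ _ → refl)
  ; connected = conn
  ; cycle-free = λ ℓ 4≤ℓ c → chordal ℓ 4≤ℓ (cycle⇒embedding c) }

base⁻ : (G : Graph (suc m)) → ∀ {M} → Base 0 0 (λ _ → ⊤) M (uncoloured G) → Connected G × Chordal G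
base⁻ G b = (_ , connected) , λ ℓ 4≤ℓ c → cycle-free ℓ 4≤ℓ (embedding⇒cycle c)
  where open Base b

-- All weights are `⊤`, so `weight` numbers the vertices by `Fin M`; excluded middle makes adjacency
-- Boolean.
base-graph : ∀ {M} → Base 0 0 (λ _ → ⊤) M X → ¬ ¬ ∃ λ (G : Graph M) → Iso X (uncoloured G)
base-graph {X} {M} b = do
  edge? ← ¬¬-∀Fin (λ i → ¬¬-∀Fin (λ j → ¬¬-excluded-middle {A = Edge X (vertex i) (vertex j)}))
  let G : Graph M
      G = record
        { adj = λ i j → does (edge? i j)
        ; adj-sym = λ i j → T⇔⇒≡ (λ t → T-does⁺ (edge? j i) (edge-sym X (T-does⁻ (edge? i j) t)))
                                 (λ t → T-does⁺ (edge? i j) (edge-sym X (T-does⁻ (edge? j i) t)))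
        ; adj-irrefl = λ i → T⇔⇒≡ (λ t → edge-irrefl X (T-does⁻ (edge? i i) t)) λ () }
  return (G , relation⇒iso {Y = uncoloured G} (λ v i → vertex i ≡ v)
    (λ v → to (v , tt) , cong proj₁ (strictlyInverseʳ (v , tt)))
    (λ i → vertex i , refl)
    (λ { {y = i} {j} p q → trans (sym (strictlyInverseˡ i))
      (trans (cong (λ v → to (v , tt)) (trans p (sym q))) (strictlyInverseˡ j)) })
    (λ p q → trans (sym p) q)
    (λ { refl refl d → T-does⁺ (edge? _ _) d })
    (λ { refl refl t → T-does⁻ (edge? _ _) t })
    (λ _ → sym (ℕ.n≤0⇒n≡0 (small _))))
  where
  open Base b
  open Inverse weight
  vertex : Fin M → V X
  vertex i = proj₁ (from i)

indicator : Bool → ℕ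
indicator b = if b then 1 else 0

tally : {A : Set} → (A → Bool) → List A → ℕ
tally p xs = sum (List.map (indicator ∘ p) xs)

length-filter≡tally : {A : Set} (p : A → Bool) (xs : List A) → length (List.filter (λ x → T? (p x)) xs) ≡ tally p xs
length-filter≡tally p []       = refl
length-filter≡tally p (x ∷ xs) with p x
... | true  = cong suc (length-filter≡tally p xs)
... | false = length-filter≡tally p xs

tally-+ : {A : Set} (p q r : A → Bool) → (∀ x → indicator (p x) ≡ indicator (q x) + indicator (r x)) →
          ∀ xs → tally p xs ≡ tally q xs + tally r xs
tally-+ p q r eq []       = refl
tally-+ p q r eq (x ∷ xs) = trans (cong₂ _+_ (eq x) (tally-+ p q r eq xs))
  (CommutativeSemigroup.interchange ℕ.+-commutativeSemigroup (indicator (q x)) (indicator (r x)) (tally q xs) (tally r xs))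

tally-≗ : {A : Set} (p q : A → Bool) → (∀ x → p x ≡ q x) → ∀ xs → tally p xs ≡ tally q xs
tally-≗ p q eq xs = cong sum (List.map-cong (cong indicator ∘ eq) xs)

≤ᵇ-zero : ∀ s → (s ≤ᵇ 0) ≡ (s ≡ᵇ 0)
≤ᵇ-zero zero    = refl
≤ᵇ-zero (suc _) = refl

≤ᵇ-suc : ∀ s a → indicator (s ≤ᵇ suc a) ≡ indicator (s ≤ᵇ a) + indicator (s ≡ᵇ suc a)
≤ᵇ-suc zero    a = refl
≤ᵇ-suc (suc s) a = <ᵇ-suc s a
  where
  <ᵇ-suc : ∀ s a → indicator (s <ᵇ suc a) ≡ indicator (s <ᵇ a) + indicator (s ≡ᵇ a)
  <ᵇ-suc zero    zero    = refl
  <ᵇ-suc zero    (suc a) = refl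
  <ᵇ-suc (suc s) zero    = refl
  <ᵇ-suc (suc s) (suc a) = <ᵇ-suc s a

∧-+ˡ : ∀ p q r c → indicator p ≡ indicator q + indicator r →
       indicator (p ∧ c) ≡ indicator (q ∧ c) + indicator (r ∧ c)
∧-+ˡ p q r true  eq rewrite ∧-identityʳ p | ∧-identityʳ q | ∧-identityʳ r = eq
∧-+ˡ p q r false eq rewrite ∧-zeroʳ p | ∧-zeroʳ q | ∧-zeroʳ r = refl

∧-+ʳ : ∀ c {p q r} → indicator p ≡ indicator q + indicator r →
       indicator (c ∧ p) ≡ indicator (c ∧ q) + indicator (c ∧ r)
∧-+ʳ true  eq = eq
∧-+ʳ false eq = refl

module _ {A : Set} (f g : A → ℕ) (xs : List A) where
  private
    le eq≤ ≤eq eq : ℕ → ℕ → ℕ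
    le  a b = tally (λ x → (f x ≤ᵇ a) ∧ (g x ≤ᵇ b)) xs
    eq≤ a b = tally (λ x → (f x ≡ᵇ a) ∧ (g x ≤ᵇ b)) xs
    ≤eq a b = tally (λ x → (f x ≤ᵇ a) ∧ (g x ≡ᵇ b)) xs
    eq  a b = tally (λ x → (f x ≡ᵇ a) ∧ (g x ≡ᵇ b)) xs

  -- The counts `le` are double partial sums of the counts `eq`; differences are taken in one
  -- variable by `step₁` and in the other by `step₂`.
  cumulative-symmetric⇒symmetric : (∀ a b → le a b ≡ le b a) → ∀ a b → eq a b ≡ eq b a
  cumulative-symmetric⇒symmetric le-sym = λ a b → step₂ a b
    where
    step₁ : ∀ a b → eq≤ a b ≡ ≤eq b a
    step₁ zero b = trans
      (tally-≗ _ _ (λ x → cong (_∧ (g x ≤ᵇ b)) (sym (≤ᵇ-zero (f x)))) xs) (trans (le-sym 0 b)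
      (tally-≗ _ _ (λ x → cong ((f x ≤ᵇ b) ∧_) (≤ᵇ-zero (g x))) xs))
    step₁ (suc a) b = ℕ.+-cancelˡ-≡ (le a b) _ _ (trans
      (sym (tally-+ _ _ _ (λ x → ∧-+ˡ (f x ≤ᵇ suc a) (f x ≤ᵇ a) (f x ≡ᵇ suc a) (g x ≤ᵇ b) (≤ᵇ-suc (f x) a)) xs)) (trans
      (le-sym (suc a) b) (trans
      (tally-+ _ _ _ (λ x → ∧-+ʳ (f x ≤ᵇ b) (≤ᵇ-suc (g x) a)) xs)
      (cong (_+ ≤eq b (suc a)) (le-sym b a)))))
    step₂ : ∀ a b → eq a b ≡ eq b a
    step₂ a zero = trans
      (tally-≗ _ _ (λ x → cong ((f x ≡ᵇ a) ∧_) (sym (≤ᵇ-zero (g x)))) xs) (trans (step₁ a 0)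
      (tally-≗ _ _ (λ x → cong (_∧ (g x ≡ᵇ a)) (≤ᵇ-zero (f x))) xs))
    step₂ a (suc b) = ℕ.+-cancelˡ-≡ (eq≤ a b) _ _ (trans
      (sym (tally-+ _ _ _ (λ x → ∧-+ʳ (f x ≡ᵇ a) (≤ᵇ-suc (g x) b)) xs)) (trans
      (step₁ a (suc b)) (trans
      (tally-+ _ _ _ (λ x → ∧-+ˡ (f x ≤ᵇ suc b) (f x ≤ᵇ b) (f x ≡ᵇ suc b) (g x ≡ᵇ a) (≤ᵇ-suc (f x) b)) xs)
      (cong (_+ eq (suc b) a) (sym (step₁ a b))))))

module _ {Gs : List (Graph (suc m))} (represents : Represents (λ G → Connected G × Chordal G) Gs) where
  open Represents represents

  within : ℕ → ℕ → Graph (suc m) → Bool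
  within a b G = (siblingNumber G ≤ᵇ a) ∧ (tuftNumber G ≤ᵇ b)

  within⁻ : ∀ a b G → T (within a b G) → siblingNumber G ≤ a × tuftNumber G ≤ b
  within⁻ a b G t = let p , q = Equivalence.to T-∧ t in ℕ.≤ᵇ⇒≤ _ _ p , ℕ.≤ᵇ⇒≤ _ _ q

  within⁺ : ∀ a b G → siblingNumber G ≤ a → tuftNumber G ≤ b → T (within a b G)
  within⁺ a b G p q = Equivalence.from T-∧ (ℕ.≤⇒≤ᵇ p , ℕ.≤⇒≤ᵇ q)

  reps-within : ∀ a b →
    Reps (λ X → (Free (clique a) X × Free (star b) X) × Base 0 0 (λ _ → ⊤) (suc m) X)
         (List.map uncoloured (List.filter (λ G → T? (within a b G)) Gs))
  reps-within a b = record
    { sound = All.map⁺ (All.tabulate λ {G} G∈ →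
        let G∈Gs , t = ∈-filter⁻ (λ G → T? (within a b G)) G∈
            s≤a , t≤b = within⁻ a b G t
            conn , chordal = All.lookup sound G∈Gs
        in (sibling≤⇒free G s≤a , tuft≤⇒free G t≤b) , base⁺ G conn chordal)
    ; distinct = AllPairs.map⁺ (AllPairs.filter⁺ (λ G → T? (within a b G))
        (AllPairs.map (λ ¬G≅H f → ¬G≅H (iso⇒≅ f)) distinct))
    ; complete = λ X ((s , t) , base) → do
        G , X≅G ← base-graph base
        let H , H∈Gs , G≅H = find (complete G (base⁻ G (base-iso X≅G base)))
            X≅H = iso-trans X≅G (≅⇒iso G≅H)
            t∈ = within⁺ a b H (free⇒sibling≤ H (free-iso (clique a) X≅H s)) (free⇒tuft≤ H (free-iso (star b) X≅H t))
        return (Any.map⁺ (lose (∈-filter⁺ (λ G → T? (within a b G)) H∈Gs t∈) X≅H))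
    }

  cumulative-symmetric : ∀ a b → tally (within a b) Gs ≡ tally (within b a) Gs
  cumulative-symmetric a b with a ℕ.≟ b
  ... | yes refl = refl
  ... | no a≢b = trans (sym (count a b)) (trans
    -- No colour is in use yet and the weight is `suc m`, so `suc (suc m)` further colours exceed
    -- it.
    (exchange-two a≢b (suc (suc m)) 0 (λ _ → tt) ℕ.≤-refl
      (reps-resp (λ ((s , t) , base) → (t , s) , base) (λ ((t , s) , base) → (s , t) , base) (reps-within a b))
      (reps-within b a))
    (count b a))
    where
    count : ∀ a b → length (List.map uncoloured (List.filter (λ G → T? (within a b G)) Gs)) ≡ tally (within a b) Gs
    count a b = trans (List.length-map uncoloured (List.filter (λ G → T? (within a b G)) Gs))
      (length-filter≡tally (within a b) Gs)

theorem7p1 : (∀ (n : ℕ) → 4 ≤ n →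
    ∀ {m : ℕ} (G : Graph m) → Connected G → ¬ (G ≅ K 2) →
    ∀ {k : ℕ} (R : Graph k) → R IsReductionOf G →
    HasInducedCycle n G ⇔ HasInducedCycle n R)
    ×
    (∀ (m : ℕ) → 1 ≤ m →
    (Gs : List (Graph m)) → Represents (λ G → Connected G × Chordal G) Gs →
    Symmetric (Σ[ Gs ] (λ G → x^ siblingNumber G y^ tuftNumber G)))
theorem7p1 =
  (λ n 4≤n G _ _ R (G↠R , _) → let open Equivalence (reduction-cycle 4≤n G↠R) in
     mk⇔ (cycle⇒embedding ∘ to ∘ embedding⇒cycle) (cycle⇒embedding ∘ from ∘ embedding⇒cycle)) ,
  λ { (suc m) _ Gs represents →
      cumulative-symmetric⇒symmetric siblingNumber tuftNumber Gs (cumulative-symmetric represents) }
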